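{- Let $p$ be an odd prime, $S\subseteq SL_2(\mathbb{F}_p)$, and $P=A\times B\subseteq(\mathbb{F}_p^2\times\mathbb{F}_p^2)\setminus\{(0,0,0,0)\}$. Assume every line through the origin contains at most $k$ points of $B$. Then \[I(P,S)\lesssim\frac{|A||B||S|^{1/2}}{p^{1/2}}+k^{1/2}p^{1/2}|A|^{1/2}|B|^{1/2}|S|^{1/2}+k|S|.\]
   Context: $I(P,S)$ is the number of pairs $((x,y),\theta)\in P\times S$ with $\theta y=x$ (matrices acting on column vectors). A line through the origin is a one-dimensional subspace of $\mathbb{F}_p^2$. $X\lesssim Y$ means $X\le C\log_2 p\cdot Y$ for a constant $C$ independent of $p,A,B,S,k$. -}

module Defs where

open import Data.Nat using (ℕ; zero; suc; _+_; _*_; NonZero)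
open import Data.Nat.DivMod using (_mod_)
open import Data.Fin using (Fin; toℕ)
open import Data.Fin.Properties using () renaming (_≟_ to _≟ᶠ_)
open import Data.Product using (_×_; _,_)
open import Data.Product.Properties using (≡-dec)
open import Data.List using (List; []; _∷_; allFin; map; filter; length)
open import Data.Nat.ListAction using (sum)
open import Data.Bool.ListAction using (any)
open import Relation.Nullary using (Dec; yes; no; does)
open import Relation.Binary.PropositionalEquality using (_≡_)
open import Data.Bool using (Bool; true; false; if_then_else_)

F : ℕ → Set
F p = Fin p

Pt : ℕ → Set
Pt p = F p × F p

-- 2x2 matrices (a , b , c , d) standing for [[a , b] , [c , d]].
Mat : ℕ → Set
Mat p = F p × F p × F p × F p

origin : (p : ℕ) .{{_ : NonZero p}} → Pt p
origin p = (0 mod p) , (0 mod p)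

_≟ₚ_ : {p : ℕ} → (x y : Pt p) → Dec (x ≡ y)
_≟ₚ_ = ≡-dec _≟ᶠ_ _≟ᶠ_

_≟ₘ_ : {p : ℕ} → (x y : Mat p) → Dec (x ≡ y)
_≟ₘ_ = ≡-dec _≟ᶠ_ (≡-dec _≟ᶠ_ (≡-dec _≟ᶠ_ _≟ᶠ_))

-- Membership of SL_2(F_p): ad - bc = 1 in F_p, i.e. ad ≡ bc + 1 (mod p).
InSL2 : (p : ℕ) .{{_ : NonZero p}} → Mat p → Set
InSL2 p (a , b , c , d) =
  ((toℕ a * toℕ d) mod p) ≡ ((toℕ b * toℕ c + 1) mod p)

act : (p : ℕ) .{{_ : NonZero p}} → Mat p → Pt p → Pt p
act p (a , b , c , d) (y₁ , y₂) =
  ((toℕ a * toℕ y₁ + toℕ b * toℕ y₂) mod p) ,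
  ((toℕ c * toℕ y₁ + toℕ d * toℕ y₂) mod p)

scale : (p : ℕ) .{{_ : NonZero p}} → F p → Pt p → Pt p
scale p t (v₁ , v₂) = ((toℕ t * toℕ v₁) mod p) , ((toℕ t * toℕ v₂) mod p)

onLine : (p : ℕ) .{{_ : NonZero p}} → Pt p → Pt p → Bool
onLine p v y = any (λ t → does (scale p t v ≟ₚ y)) (allFin p)

lineCount : (p : ℕ) .{{_ : NonZero p}} → Pt p → List (Pt p) → ℕ
lineCount p v B = length (filter (λ y → onLine p v y Data.Bool.≟ true) B)

incidences : (p : ℕ) .{{_ : NonZero p}} → List (Pt p) → List (Pt p) → List (Mat p) → ℕ
incidences p A B S =
  sum (map (λ x → sum (map (λ y → sum (map (λ θ →
    if does (act p θ y ≟ₚ x) then 1 else 0) S)) B)) A)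

{-# OPTIONS --safe #-}

-- Write r θ for the number of (x , y) ∈ P with θ y = x. By Cauchy-Schwarz I² ≤ |S| ∑_{θ ∈ S} (r θ)²,
-- and (r θ)² counts pairs u = (x , y), u′ = (x′ , y′) in P with θ y = x and θ y′ = x′. If y and y′ are
-- independent, then θ is unique and ⟨ u , u′ ⟩ = det x x′ - det y y′ vanishes; otherwise u′ is
-- proportional to u and at most p matrices qualify. There are at most k |P| proportional pairs.
-- The pairs orthogonal for the symplectic form ⟨_,_⟩ on F p ⁴ are counted by a second moment: with
-- K c = p [c = 0] - 1 and δ u v the number of nonzero t with v = t u, the rows K ⟨ u , _ ⟩ and
-- K ⟨ u′ , _ ⟩ are uncorrelated unless u and u′ are proportional, so that expanding
-- ∑_v (∑_{u ∈ P} (K ⟨ u , v ⟩ - p² δ u v))² ≥ 0 gives ∑_{u,u′ ∈ P} K ⟨ u , u′ ⟩ ≤ p² ∑_{u,u′ ∈ P} δ u u′.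
-- This loses no logarithm, and pairs with y = 0 contribute no incidence because (0 , 0) ∉ P.

module Submission where

open import Defs
open import Algebra using (CommutativeRing)
import Algebra.Properties.Ring
import Algebra.Solver.Ring
open import Algebra.Solver.Ring.AlmostCommutativeRing
  using (AlmostCommutativeRing; fromCommutativeRing; _-Raw-AlmostCommutative⟶_)
open import Data.Bool as Bool using (Bool; true; false; if_then_else_)
open import Data.Bool.ListAction using (any)
open import Data.Bool.Properties using (∨-zeroʳ)
open import Data.Fin using (toℕ)
open import Data.Fin.Properties using (toℕ-injective; toℕ-fromℕ<; toℕ<n) renaming (_≟_ to _≟ᶠ_)
open import Data.Integer as ℤ using (ℤ; +_; -[1+_]; 0ℤ; 1ℤ)
import Data.Integer.Properties as ℤ
open import Data.Integer.Solver using (module +-*-Solver)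
open import Data.List using (List; []; _∷_; _++_; map; filter; length; allFin; cartesianProduct)
open import Data.List.Membership.Propositional using (_∈_)
open import Data.List.Membership.Propositional.Properties
  using (∈-allFin; ∈-filter⁻; ∈-cartesianProduct⁺; ∈-cartesianProduct⁻)
open import Data.List.Properties using (length-++; length-map; length-filter; length-tabulate)
open import Data.List.Relation.Unary.All as All using (All; []; _∷_)
open import Data.List.Relation.Unary.AllPairs using ([]; _∷_)
open import Data.List.Relation.Unary.Any using (here; there)
open import Data.List.Relation.Unary.Unique.Propositional using (Unique)
import Data.List.Relation.Unary.Unique.Propositional.Properties as Unique
open import Data.Maybe using (Maybe; just; nothing)
open import Data.Nat as ℕ using (ℕ; zero; suc; NonZero; nonTrivial⇒n>1; ≢-nonZero)
open import Data.Nat.Coprimality using (prime⇒coprime; coprime-Bézout)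
open import Data.Nat.DivMod
  using (_%_; _mod_; %-distribˡ-+; %-distribˡ-*; m<n⇒m%n≡m; m%n<n; n%n≡0)
open import Data.Nat.Divisibility using (_∣_)
open import Data.Nat.GCD using (module Bézout)
open import Data.Nat.ListAction using (sum)
open import Data.Nat.Logarithm using (⌊log₂_⌋; ⌊log₂⌋-mono-≤; ⌊log₂[2^n]⌋≡n)
open import Data.Nat.Primality using (Prime; prime⇒nonTrivial)
import Data.Nat.Properties as ℕ
import Data.Nat.Solver
open import Data.Product using (_×_; _,_; ∃; ∃-syntax; proj₁; proj₂)
open import Data.Product.Properties using (≡-dec)
open import Data.Sum using (_⊎_; inj₁; inj₂)
open import Function using (_∘_; case_of_; id)
open import Relation.Binary.Definitions using (DecidableEquality)
open import Relation.Binary.PropositionalEquality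
open import Relation.Binary.PropositionalEquality.Properties using (isEquivalence)
open import Relation.Nullary using (Dec; yes; no; does; ¬_; contradiction)
open import Relation.Nullary.Decidable using (¬?; dec-true; dec-false; _×-dec_)
open import Relation.Unary using (Decidable)

-- Sums over lists

-- Orthogonality is the natural relaxation of lying on a common matrix. The graph of a matrix of
-- determinant 1, the plane of all (θ y , y), is isotropic for ⟨_,_⟩, because θ preserves `det`.
--
-- Proportional pairs enter twice. Such a pair may share as many as p matrices, and `K` cannot
-- distinguish u from t u, so the Gram matrix of its rows is a multiple of δ and not of the
-- identity. After multiplication by p both effects have the same size, p² k |P|, which is the
-- second term of the bound.
--
-- Neither additive characters nor eigenvalues are needed to compute correlations. A sum over all v
-- is averaged over the lines v + s w, and w is chosen so that one form runs through every residue
-- while the other stays fixed.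
--
-- Square roots and division are avoided: the inequality is squared, multiplied by p, and the three
-- terms on the right are squared separately. Since X² + Y² + Z² ≤ (X + Y + Z)² for nonnegative X,
-- Y, Z, the squared form gives back the original one.

module ListSums where

  open import Data.Integer using (_+_; _*_; -_; _-_; _≤_; +≤+)

  private variable
    X Y P Q : Set

  ∑ : List X → (X → ℤ) → ℤ
  ∑ []       f = 0ℤ
  ∑ (x ∷ xs) f = f x + ∑ xs f

  infixr 8 ∑
  syntax ∑ xs (λ x → e) = ∑[ x ← xs ] e

  ∑-cong-∈ : ∀ (xs : List X) {f g} → (∀ x → x ∈ xs → f x ≡ g x) → ∑ xs f ≡ ∑ xs g
  ∑-cong-∈ []       f≡g = refl
  ∑-cong-∈ (x ∷ xs) f≡g =
    cong₂ _+_ (f≡g x (here refl)) (∑-cong-∈ xs (λ y y∈xs → f≡g y (there y∈xs)))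

  ∑-cong : ∀ (xs : List X) {f g} → (∀ x → f x ≡ g x) → ∑ xs f ≡ ∑ xs g
  ∑-cong xs f≡g = ∑-cong-∈ xs (λ x _ → f≡g x)

  ∑-mono-∈ : ∀ (xs : List X) {f g} → (∀ x → x ∈ xs → f x ≤ g x) → ∑ xs f ≤ ∑ xs g
  ∑-mono-∈ []       f≤g = ℤ.≤-refl
  ∑-mono-∈ (x ∷ xs) f≤g =
    ℤ.+-mono-≤ (f≤g x (here refl)) (∑-mono-∈ xs (λ y y∈xs → f≤g y (there y∈xs)))

  ∑-mono : ∀ (xs : List X) {f g} → (∀ x → f x ≤ g x) → ∑ xs f ≤ ∑ xs g
  ∑-mono xs f≤g = ∑-mono-∈ xs (λ x _ → f≤g x)

  ∑-const : ∀ (xs : List X) c → ∑[ _ ← xs ] c ≡ + length xs * c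
  ∑-const []       c = sym (ℤ.*-zeroˡ c)
  ∑-const (x ∷ xs) c = trans (cong (λ z → c + z) (∑-const xs c)) (sym (ℤ.suc-* (+ length xs) c))

  ∑-zero : ∀ (xs : List X) → ∑[ _ ← xs ] 0ℤ ≡ 0ℤ
  ∑-zero xs = trans (∑-const xs 0ℤ) (ℤ.*-zeroʳ (+ length xs))

  ∑-nonneg : ∀ (xs : List X) {f} → (∀ x → 0ℤ ≤ f x) → 0ℤ ≤ ∑ xs f
  ∑-nonneg xs 0≤f = ℤ.≤-trans (ℤ.≤-reflexive (sym (∑-zero xs))) (∑-mono xs 0≤f)

  ∑-+ : ∀ (xs : List X) f g → ∑[ x ← xs ] (f x + g x) ≡ ∑ xs f + ∑ xs g
  ∑-+ []       f g = refl
  ∑-+ (x ∷ xs) f g = trans (cong (λ z → f x + g x + z) (∑-+ xs f g))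
    (solve 4 (λ a b c d → (a :+ b) :+ (c :+ d) := (a :+ c) :+ (b :+ d)) refl
      (f x) (g x) (∑ xs f) (∑ xs g))
    where open +-*-Solver

  ∑-*ˡ : ∀ c (xs : List X) f → ∑[ x ← xs ] (c * f x) ≡ c * ∑ xs f
  ∑-*ˡ c []       f = sym (ℤ.*-zeroʳ c)
  ∑-*ˡ c (x ∷ xs) f =
    trans (cong (λ z → c * f x + z) (∑-*ˡ c xs f)) (sym (ℤ.*-distribˡ-+ c (f x) (∑ xs f)))

  ∑-*ʳ : ∀ c (xs : List X) f → ∑[ x ← xs ] (f x * c) ≡ ∑ xs f * c
  ∑-*ʳ c xs f = begin
    ∑[ x ← xs ] (f x * c) ≡⟨ ∑-cong xs (λ x → ℤ.*-comm (f x) c) ⟩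
    ∑[ x ← xs ] (c * f x) ≡⟨ ∑-*ˡ c xs f ⟩
    c * ∑ xs f            ≡⟨ ℤ.*-comm c (∑ xs f) ⟩
    ∑ xs f * c            ∎
    where open ≡-Reasoning

  ∑-swap : ∀ (xs : List X) (ys : List Y) (f : X → Y → ℤ) →
           ∑[ x ← xs ] ∑[ y ← ys ] f x y ≡ ∑[ y ← ys ] ∑[ x ← xs ] f x y
  ∑-swap []       ys f = sym (∑-zero ys)
  ∑-swap (x ∷ xs) ys f = trans (cong (λ z → ∑ ys (f x) + z) (∑-swap xs ys f))
    (sym (∑-+ ys (f x) (λ y → ∑[ x ← xs ] f x y)))

  ∑-*-∑ : ∀ (xs : List X) (ys : List Y) f g →
          ∑ xs f * ∑ ys g ≡ ∑[ x ← xs ] ∑[ y ← ys ] (f x * g y)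
  ∑-*-∑ xs ys f g = begin
    ∑ xs f * ∑ ys g                     ≡⟨ ∑-*ʳ (∑ ys g) xs f ⟨
    ∑[ x ← xs ] (f x * ∑ ys g)          ≡⟨ ∑-cong xs (λ x → sym (∑-*ˡ (f x) ys g)) ⟩
    ∑[ x ← xs ] ∑[ y ← ys ] (f x * g y) ∎
    where open ≡-Reasoning

  ∑-++ : ∀ (xs ys : List X) f → ∑ (xs ++ ys) f ≡ ∑ xs f + ∑ ys f
  ∑-++ []       ys f = sym (ℤ.+-identityˡ _)
  ∑-++ (x ∷ xs) ys f = trans (cong (λ z → f x + z) (∑-++ xs ys f)) (sym (ℤ.+-assoc (f x) _ _))

  ∑-map : ∀ (h : X → Y) xs f → ∑ (map h xs) f ≡ ∑ xs (f ∘ h)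
  ∑-map h []       f = refl
  ∑-map h (x ∷ xs) f = cong (λ z → f (h x) + z) (∑-map h xs f)

  ∑-cartesianProduct : ∀ (xs : List X) (ys : List Y) f →
    ∑ (cartesianProduct xs ys) f ≡ ∑[ x ← xs ] ∑[ y ← ys ] f (x , y)
  ∑-cartesianProduct []       ys f = refl
  ∑-cartesianProduct (x ∷ xs) ys f = trans (∑-++ (map (x ,_) ys) _ f)
    (cong₂ _+_ (∑-map (x ,_) ys f) (∑-cartesianProduct xs ys f))

  ∑-filter-≤ : ∀ {R : X → Set} (R? : Decidable R) xs {f} → (∀ x → 0ℤ ≤ f x) →
               ∑ (filter R? xs) f ≤ ∑ xs f
  ∑-filter-≤ R? []       0≤f = ℤ.≤-refl
  ∑-filter-≤ R? (x ∷ xs) {f} 0≤f with does (R? x)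
  ... | true  = ℤ.+-monoʳ-≤ (f x) (∑-filter-≤ R? xs 0≤f)
  ... | false = subst (_≤ f x + ∑ xs f) (ℤ.+-identityˡ _) (ℤ.+-mono-≤ (0≤f x) (∑-filter-≤ R? xs 0≤f))

  ∑-filter-≡ : ∀ {R : X → Set} (R? : Decidable R) xs {f} → (∀ x → x ∈ xs → ¬ R x → f x ≡ 0ℤ) →
               ∑ (filter R? xs) f ≡ ∑ xs f
  ∑-filter-≡ R? []       f≡0 = refl
  ∑-filter-≡ R? (x ∷ xs) {f} f≡0 with R? x | ∑-filter-≡ R? xs (λ y y∈xs → f≡0 y (there y∈xs))
  ... | yes _  | ih = cong (λ z → f x + z) ih
  ... | no ¬Rx | ih = trans ih (trans (sym (ℤ.+-identityˡ _))
                        (cong (_+ ∑ xs f) (sym (f≡0 x (here refl) ¬Rx))))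

  pos-sum : ∀ (xs : List X) g → + sum (map g xs) ≡ ∑[ x ← xs ] (+ g x)
  pos-sum []       g = refl
  pos-sum (x ∷ xs) g = cong (λ z → + g x + z) (pos-sum xs g)

  square-nonneg : ∀ i → 0ℤ ≤ i * i
  square-nonneg (+ n)    = subst (0ℤ ≤_) (ℤ.pos-* n n) (+≤+ ℕ.z≤n)
  square-nonneg -[1+ n ] = +≤+ ℕ.z≤n

  -- The two sides differ by half of ∑ₓ ∑_y (f x - f y)².
  cauchy-schwarz : ∀ (xs : List X) f → ∑ xs f * ∑ xs f ≤ + length xs * ∑[ x ← xs ] (f x * f x)
  cauchy-schwarz xs f = ℤ.*-cancelˡ-≤-pos _ _ (+ 2) (ℤ.0≤i-j⇒j≤i (subst (0ℤ ≤_) expand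
    (∑-nonneg xs (λ x → ∑-nonneg xs (λ y → square-nonneg (f x - f y))))))
    where
    open ≡-Reasoning
    open +-*-Solver
    n s₁ s₂ : ℤ
    n  = + length xs
    s₁ = ∑ xs f
    s₂ = ∑[ x ← xs ] (f x * f x)
    inner : ∀ x → ∑[ y ← xs ] ((f x - f y) * (f x - f y)) ≡ n * (f x * f x) + (- (+ 2) * s₁ * f x + s₂)
    inner x = begin
      ∑[ y ← xs ] ((f x - f y) * (f x - f y))
        ≡⟨ ∑-cong xs (λ y → solve 2 (λ a b → (a :- b) :* (a :- b) :=
             a :* a :+ ((:- con (+ 2) :* a) :* b :+ b :* b)) refl (f x) (f y)) ⟩
      ∑[ y ← xs ] (f x * f x + ((- (+ 2) * f x) * f y + f y * f y))
        ≡⟨ trans (∑-+ xs _ _) (cong₂ _+_ (∑-const xs _) (trans (∑-+ xs _ _)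
             (cong (_+ s₂) (∑-*ˡ (- (+ 2) * f x) xs f)))) ⟩
      n * (f x * f x) + ((- (+ 2) * f x) * s₁ + s₂)
        ≡⟨ cong (λ z → n * (f x * f x) + (z + s₂))
             (solve 2 (λ a b → (:- con (+ 2) :* a) :* b := (:- con (+ 2) :* b) :* a) refl (f x) s₁) ⟩
      n * (f x * f x) + (- (+ 2) * s₁ * f x + s₂) ∎
    expand : ∑[ x ← xs ] ∑[ y ← xs ] ((f x - f y) * (f x - f y)) ≡ + 2 * (n * s₂) - + 2 * (s₁ * s₁)
    expand = begin
      ∑[ x ← xs ] ∑[ y ← xs ] ((f x - f y) * (f x - f y)) ≡⟨ ∑-cong xs inner ⟩
      ∑[ x ← xs ] (n * (f x * f x) + (- (+ 2) * s₁ * f x + s₂))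
        ≡⟨ trans (∑-+ xs _ _) (cong₂ _+_ (∑-*ˡ n xs _) (trans (∑-+ xs _ _)
             (cong₂ _+_ (∑-*ˡ (- (+ 2) * s₁) xs f) (∑-const xs s₂)))) ⟩
      n * s₂ + (- (+ 2) * s₁ * s₁ + n * s₂)
        ≡⟨ solve 3 (λ a b c → a :* c :+ ((:- con (+ 2) :* b) :* b :+ a :* c) :=
             con (+ 2) :* (a :* c) :- con (+ 2) :* (b :* b)) refl n s₁ s₂ ⟩
      + 2 * (n * s₂) - + 2 * (s₁ * s₁) ∎

  -- Indicators

  𝟙 : Dec P → ℤ
  𝟙 P? = if does P? then 1ℤ else 0ℤ

  𝟙-true : (P? : Dec P) → P → 𝟙 P? ≡ 1ℤ
  𝟙-true P? p rewrite dec-true P? p = refl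

  𝟙-false : (P? : Dec P) → ¬ P → 𝟙 P? ≡ 0ℤ
  𝟙-false P? ¬p rewrite dec-false P? ¬p = refl

  𝟙-nonneg : (P? : Dec P) → 0ℤ ≤ 𝟙 P?
  𝟙-nonneg (yes _) = +≤+ ℕ.z≤n
  𝟙-nonneg (no  _) = +≤+ ℕ.z≤n

  𝟙-≤-if : (P? : Dec P) {z : ℤ} → (P → 1ℤ ≤ z) → 0ℤ ≤ z → 𝟙 P? ≤ z
  𝟙-≤-if (yes p) 1≤z _   = 1≤z p
  𝟙-≤-if (no  _) _   0≤z = 0≤z

  𝟙-mono : (P? : Dec P) (Q? : Dec Q) → (P → Q) → 𝟙 P? ≤ 𝟙 Q?
  𝟙-mono P? Q? f = 𝟙-≤-if P? (λ p → ℤ.≤-reflexive (sym (𝟙-true Q? (f p)))) (𝟙-nonneg Q?)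

  𝟙-cong : (P? : Dec P) (Q? : Dec Q) → (P → Q) → (Q → P) → 𝟙 P? ≡ 𝟙 Q?
  𝟙-cong P? Q? f g = ℤ.≤-antisym (𝟙-mono P? Q? f) (𝟙-mono Q? P? g)

  𝟙-*-cong : (P? : Dec P) {y z : ℤ} → (P → y ≡ z) → 𝟙 P? * y ≡ 𝟙 P? * z
  𝟙-*-cong (yes p) y≡z = cong (1ℤ *_) (y≡z p)
  𝟙-*-cong (no _)  _   = refl

  𝟙-× : (P? : Dec P) (Q? : Dec Q) → 𝟙 (P? ×-dec Q?) ≡ 𝟙 P? * 𝟙 Q?
  𝟙-× (yes _) (yes _) = refl
  𝟙-× (yes _) (no  _) = refl
  𝟙-× (no  _) (yes _) = refl
  𝟙-× (no  _) (no  _) = refl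

  𝟙-*-mono : {R S : Set} (P? : Dec P) (Q? : Dec Q) (R? : Dec R) (S? : Dec S) →
             (P → Q → R × S) → 𝟙 P? * 𝟙 Q? ≤ 𝟙 R? * 𝟙 S?
  𝟙-*-mono P? Q? R? S? f = subst₂ _≤_ (𝟙-× P? Q?) (𝟙-× R? S?)
    (𝟙-mono (P? ×-dec Q?) (R? ×-dec S?) (λ (p , q) → f p q))

  𝟙-*-monoʳ : (P? : Dec P) {y z : ℤ} → y ≤ z → 𝟙 P? * y ≤ 𝟙 P? * z
  𝟙-*-monoʳ (yes _) y≤z = subst₂ _≤_ (sym (ℤ.*-identityˡ _)) (sym (ℤ.*-identityˡ _)) y≤z
  𝟙-*-monoʳ (no _)  _   = ℤ.≤-refl

  ∑-𝟙-filter : ∀ {R : X → Set} (R? : Decidable R) xs → ∑[ x ← xs ] 𝟙 (R? x) ≡ + length (filter R? xs)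
  ∑-𝟙-filter R? []       = refl
  ∑-𝟙-filter R? (x ∷ xs) with does (R? x)
  ... | true  = cong (λ z → 1ℤ + z) (∑-𝟙-filter R? xs)
  ... | false = trans (ℤ.+-identityˡ _) (∑-𝟙-filter R? xs)

  length-cartesianProduct : ∀ (xs : List X) (ys : List Y) →
                            length (cartesianProduct xs ys) ≡ length xs ℕ.* length ys
  length-cartesianProduct []       ys = refl
  length-cartesianProduct (x ∷ xs) ys = trans (length-++ (map (x ,_) ys))
    (cong₂ ℕ._+_ (length-map (x ,_) ys) (length-cartesianProduct xs ys))

  module _ (_≟_ : DecidableEquality X) where

    ∑-𝟙-∉ : ∀ {xs y} → All (y ≢_) xs → ∑[ x ← xs ] 𝟙 (x ≟ y) ≡ 0ℤ
    ∑-𝟙-∉ []           = refl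
    ∑-𝟙-∉ (y≢x ∷ y∉xs) = cong₂ _+_ (𝟙-false (_ ≟ _) (y≢x ∘ sym)) (∑-𝟙-∉ y∉xs)

    ∑-𝟙-unique-≤1 : ∀ {xs} → Unique xs → ∀ y → ∑[ x ← xs ] 𝟙 (x ≟ y) ≤ 1ℤ
    ∑-𝟙-unique-≤1 []                      y = +≤+ ℕ.z≤n
    ∑-𝟙-unique-≤1 {x ∷ xs} (x∉xs ∷ uniq) y with x ≟ y
    ... | yes refl = ℤ.≤-reflexive (cong (λ z → 1ℤ + z) (∑-𝟙-∉ x∉xs))
    ... | no _     = subst (_≤ 1ℤ) (sym (ℤ.+-identityˡ _)) (∑-𝟙-unique-≤1 uniq y)

    ∑-𝟙-∈-≥1 : ∀ {xs y} → y ∈ xs → 1ℤ ≤ ∑[ x ← xs ] 𝟙 (x ≟ y)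
    ∑-𝟙-∈-≥1 {x ∷ xs} {y} (here refl) =
      ℤ.+-mono-≤ (ℤ.≤-reflexive (sym (𝟙-true (x ≟ y) refl))) (∑-nonneg xs (λ z → 𝟙-nonneg (z ≟ y)))
    ∑-𝟙-∈-≥1 {x ∷ xs} {y} (there y∈xs) =
      ℤ.+-mono-≤ (𝟙-nonneg (x ≟ y)) (∑-𝟙-∈-≥1 y∈xs)

  -- Finite types, delta functions and reindexing along bijections.

  record Enumeration (X : Set) : Set where
    field
      _≟_      : DecidableEquality X
      elements : List X
      unique   : Unique elements
      complete : ∀ x → x ∈ elements

    -- The sifting property: `unique` allows at most one hit at `y`, and `complete` supplies one.
    ∑-δ : ∀ f y → ∑[ x ← elements ] (𝟙 (x ≟ y) * f x) ≡ f y
    ∑-δ f y = begin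
      ∑[ x ← elements ] (𝟙 (x ≟ y) * f x) ≡⟨ ∑-cong elements (λ x → 𝟙-*-cong (x ≟ y) (cong f)) ⟩
      ∑[ x ← elements ] (𝟙 (x ≟ y) * f y) ≡⟨ ∑-*ʳ (f y) elements _ ⟩
      ∑[ x ← elements ] 𝟙 (x ≟ y) * f y
        ≡⟨ cong (_* f y) (ℤ.≤-antisym (∑-𝟙-unique-≤1 _≟_ unique y) (∑-𝟙-∈-≥1 _≟_ (complete y))) ⟩
      1ℤ * f y ≡⟨ ℤ.*-identityˡ (f y) ⟩
      f y ∎
      where open ≡-Reasoning


  open Enumeration using (elements)

  _×ᴱ_ : Enumeration X → Enumeration Y → Enumeration (X × Y)
  E ×ᴱ E′ = record
    { _≟_      = ≡-dec X._≟_ Y._≟_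
    ; elements = cartesianProduct X.elements Y.elements
    ; unique   = Unique.cartesianProduct⁺ X.unique Y.unique
    ; complete = λ (x , y) → ∈-cartesianProduct⁺ (X.complete x) (Y.complete y)
    }
    where
    module X = Enumeration E
    module Y = Enumeration E′

  -- Both sides sum `f y` over the graph of the bijection, which is cut out equally by `y ≡ to x`
  -- and by `x ≡ from y`.
  ∑-reindex : (E : Enumeration X) (E′ : Enumeration Y) (to : X → Y) (from : Y → X) →
              (∀ x → from (to x) ≡ x) → (∀ y → to (from y) ≡ y) →
              ∀ f → ∑[ x ← elements E ] f (to x) ≡ ∑ (elements E′) f
  ∑-reindex E E′ to from from∘to to∘from f = begin
    ∑[ x ← X.elements ] f (to x)
      ≡⟨ ∑-cong X.elements (λ x → Y.∑-δ f (to x)) ⟨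
    ∑[ x ← X.elements ] ∑[ y ← Y.elements ] (𝟙 (y Y.≟ to x) * f y)
      ≡⟨ ∑-swap X.elements Y.elements (λ x y → 𝟙 (y Y.≟ to x) * f y) ⟩
    ∑[ y ← Y.elements ] ∑[ x ← X.elements ] (𝟙 (y Y.≟ to x) * f y)
      ≡⟨ ∑-cong Y.elements (λ y → ∑-cong X.elements (λ x → cong (_* f y)
           (𝟙-cong (y Y.≟ to x) (x X.≟ from y)
             (λ { refl → sym (from∘to x) }) (λ { refl → sym (to∘from y) })))) ⟩
    ∑[ y ← Y.elements ] ∑[ x ← X.elements ] (𝟙 (x X.≟ from y) * f y)
      ≡⟨ ∑-cong Y.elements (λ y → X.∑-δ (λ _ → f y) (from y)) ⟩
    ∑ Y.elements f ∎
    where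
    open ≡-Reasoning
    module X = Enumeration E
    module Y = Enumeration E′

-- The ring of residues modulo p

module Residues (p : ℕ) .{{_ : NonZero p}} where

  infixl 6 _⊕_
  infixl 7 _⊗_
  infix  8 ⊖_

  π : ℕ → F p
  π n = n mod p

  0# 1# : F p
  0# = π 0
  1# = π 1

  toℕ-π : ∀ n → toℕ (π n) ≡ n % p
  toℕ-π n = toℕ-fromℕ< (m%n<n n p)

  π-cong : ∀ {m n} → m % p ≡ n % p → π m ≡ π n
  π-cong {m} {n} eq = toℕ-injective (trans (toℕ-π m) (trans eq (sym (toℕ-π n))))

  π-toℕ : ∀ a → π (toℕ a) ≡ a
  π-toℕ a = toℕ-injective (trans (toℕ-π (toℕ a)) (m<n⇒m%n≡m (toℕ<n a)))

  -- A view that presents every element as a reduction, so that the ring laws descend from ℕ along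
  -- the surjective homomorphism `π`.
  data Residue : F p → Set where
    res : ∀ n → Residue (π n)

  opaque

    -- Opaque, so that conversion never unfolds `mod`. Outside the block, `π-+`, `π-*` and `π-⊗`
    -- carry the link to arithmetic on ℕ.
    _⊕_ _⊗_ : F p → F p → F p
    a ⊕ b = π (toℕ a ℕ.+ toℕ b)
    a ⊗ b = π (toℕ a ℕ.* toℕ b)

    ⊖_ : F p → F p
    ⊖ a = π (p ℕ.∸ toℕ a)

    π-+ : ∀ m n → π (m ℕ.+ n) ≡ π m ⊕ π n
    π-+ m n = π-cong (trans (%-distribˡ-+ m n p)
      (cong₂ (λ x y → (x ℕ.+ y) % p) (sym (toℕ-π m)) (sym (toℕ-π n))))

    π-* : ∀ m n → π (m ℕ.* n) ≡ π m ⊗ π n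
    π-* m n = π-cong (trans (%-distribˡ-* m n p)
      (cong₂ (λ x y → (x ℕ.* y) % p) (sym (toℕ-π m)) (sym (toℕ-π n))))

    π-p : π p ≡ 0#
    π-p = π-cong (trans (n%n≡0 p) (sym (m<n⇒m%n≡m (ℕ.>-nonZero⁻¹ p))))

    residue : ∀ a → Residue a
    residue a = subst Residue (π-toℕ a) (res (toℕ a))

    ⊕-assoc : ∀ a b c → (a ⊕ b) ⊕ c ≡ a ⊕ (b ⊕ c)
    ⊕-assoc a b c with residue a | residue b | residue c
    ... | res l | res m | res n = begin
      (π l ⊕ π m) ⊕ π n     ≡⟨ cong (_⊕ π n) (π-+ l m) ⟨
      π (l ℕ.+ m) ⊕ π n     ≡⟨ π-+ (l ℕ.+ m) n ⟨
      π (l ℕ.+ m ℕ.+ n)     ≡⟨ cong π (ℕ.+-assoc l m n) ⟩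
      π (l ℕ.+ (m ℕ.+ n))   ≡⟨ π-+ l (m ℕ.+ n) ⟩
      π l ⊕ π (m ℕ.+ n)     ≡⟨ cong (π l ⊕_) (π-+ m n) ⟩
      π l ⊕ (π m ⊕ π n)     ∎
      where open ≡-Reasoning

    ⊗-assoc : ∀ a b c → (a ⊗ b) ⊗ c ≡ a ⊗ (b ⊗ c)
    ⊗-assoc a b c with residue a | residue b | residue c
    ... | res l | res m | res n = begin
      (π l ⊗ π m) ⊗ π n     ≡⟨ cong (_⊗ π n) (π-* l m) ⟨
      π (l ℕ.* m) ⊗ π n     ≡⟨ π-* (l ℕ.* m) n ⟨
      π (l ℕ.* m ℕ.* n)     ≡⟨ cong π (ℕ.*-assoc l m n) ⟩
      π (l ℕ.* (m ℕ.* n))   ≡⟨ π-* l (m ℕ.* n) ⟩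
      π l ⊗ π (m ℕ.* n)     ≡⟨ cong (π l ⊗_) (π-* m n) ⟩
      π l ⊗ (π m ⊗ π n)     ∎
      where open ≡-Reasoning

    ⊗-distribˡ-⊕ : ∀ a b c → a ⊗ (b ⊕ c) ≡ (a ⊗ b) ⊕ (a ⊗ c)
    ⊗-distribˡ-⊕ a b c with residue a | residue b | residue c
    ... | res l | res m | res n = begin
      π l ⊗ (π m ⊕ π n)           ≡⟨ cong (π l ⊗_) (π-+ m n) ⟨
      π l ⊗ π (m ℕ.+ n)           ≡⟨ π-* l (m ℕ.+ n) ⟨
      π (l ℕ.* (m ℕ.+ n))         ≡⟨ cong π (ℕ.*-distribˡ-+ l m n) ⟩
      π (l ℕ.* m ℕ.+ l ℕ.* n)     ≡⟨ π-+ (l ℕ.* m) (l ℕ.* n) ⟩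
      π (l ℕ.* m) ⊕ π (l ℕ.* n)   ≡⟨ cong₂ _⊕_ (π-* l m) (π-* l n) ⟩
      (π l ⊗ π m) ⊕ (π l ⊗ π n)   ∎
      where open ≡-Reasoning

    ⊕-comm : ∀ a b → a ⊕ b ≡ b ⊕ a
    ⊕-comm a b = cong π (ℕ.+-comm (toℕ a) (toℕ b))

    ⊗-comm : ∀ a b → a ⊗ b ≡ b ⊗ a
    ⊗-comm a b = cong π (ℕ.*-comm (toℕ a) (toℕ b))

    ⊕-identityˡ : ∀ a → 0# ⊕ a ≡ a
    ⊕-identityˡ a with residue a
    ... | res n = sym (π-+ 0 n)

    ⊗-identityˡ : ∀ a → 1# ⊗ a ≡ a
    ⊗-identityˡ a with residue a
    ... | res n = trans (sym (π-* 1 n)) (cong π (ℕ.*-identityˡ n))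

    ⊖-inverseʳ : ∀ a → a ⊕ ⊖ a ≡ 0#
    ⊖-inverseʳ a = begin
      a ⊕ ⊖ a                       ≡⟨ cong (_⊕ ⊖ a) (π-toℕ a) ⟨
      π (toℕ a) ⊕ ⊖ a               ≡⟨ π-+ (toℕ a) (p ℕ.∸ toℕ a) ⟨
      π (toℕ a ℕ.+ (p ℕ.∸ toℕ a))   ≡⟨ cong π (ℕ.m+[n∸m]≡n (ℕ.<⇒≤ (toℕ<n a))) ⟩
      π p                           ≡⟨ π-p ⟩
      0#                            ∎
      where open ≡-Reasoning

    π-⊗ : ∀ a b → π (toℕ a ℕ.* toℕ b) ≡ a ⊗ b
    π-⊗ a b = refl

  commutativeRing : CommutativeRing _ _
  commutativeRing = record
    { Carrier = F p ; _≈_ = _≡_ ; _+_ = _⊕_ ; _*_ = _⊗_ ; -_ = ⊖_ ; 0# = 0# ; 1# = 1#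
    ; isCommutativeRing = record
      { isRing = record
        { +-isAbelianGroup = record
          { isGroup = record
            { isMonoid = record
              { isSemigroup = record
                { isMagma = record { isEquivalence = isEquivalence ; ∙-cong = cong₂ _⊕_ }
                ; assoc = ⊕-assoc }
              ; identity = ⊕-identityˡ , λ a → trans (⊕-comm a 0#) (⊕-identityˡ a) }
            ; inverse = (λ a → trans (⊕-comm (⊖ a) a) (⊖-inverseʳ a)) , ⊖-inverseʳ
            ; ⁻¹-cong = cong ⊖_ }
          ; comm = ⊕-comm }
        ; *-cong = cong₂ _⊗_
        ; *-assoc = ⊗-assoc
        ; *-identity = ⊗-identityˡ , λ a → trans (⊗-comm a 1#) (⊗-identityˡ a)
        ; distrib = ⊗-distribˡ-⊕ , λ a b c → trans (⊗-comm (b ⊕ c) a)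
            (trans (⊗-distribˡ-⊕ a b c) (cong₂ _⊕_ (⊗-comm a b) (⊗-comm a c))) }
      ; *-comm = ⊗-comm } }

  open Algebra.Properties.Ring (CommutativeRing.ring commutativeRing) using
    (-‿distribˡ-*; -‿distribʳ-*; -0#≈0#; -‿involutive; -‿+-comm)

  πℤ : ℤ → F p
  πℤ (+ n)    = π n
  πℤ -[1+ n ] = ⊖ π (suc n)

  πℤ-neg : ∀ i → πℤ (ℤ.- i) ≡ ⊖ πℤ i
  πℤ-neg (+ zero)  = sym -0#≈0#
  πℤ-neg (+ suc n) = refl
  πℤ-neg -[1+ n ]  = sym (-‿involutive (π (suc n)))

  πℤ-⊖ : ∀ m n → πℤ (m ℤ.⊖ n) ≡ π m ⊕ ⊖ π n
  πℤ-⊖ m zero = sym (trans (cong (π m ⊕_) -0#≈0#) (trans (⊕-comm (π m) 0#) (⊕-identityˡ (π m))))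
  πℤ-⊖ zero (suc n) = sym (⊕-identityˡ _)
  πℤ-⊖ (suc m) (suc n) = begin
    πℤ (suc m ℤ.⊖ suc n)                ≡⟨ cong πℤ (ℤ.[1+m]⊖[1+n]≡m⊖n m n) ⟩
    πℤ (m ℤ.⊖ n)                        ≡⟨ πℤ-⊖ m n ⟩
    -- Inserting `1# ⊕ ⊖ 1#` raises both arguments by one.
    π m ⊕ ⊖ π n                         ≡⟨ cong (π m ⊕_) (⊕-identityˡ (⊖ π n)) ⟨
    π m ⊕ (0# ⊕ ⊖ π n)                  ≡⟨ cong (λ z → π m ⊕ (z ⊕ ⊖ π n)) (⊖-inverseʳ 1#) ⟨
    π m ⊕ ((1# ⊕ ⊖ 1#) ⊕ ⊖ π n)         ≡⟨ cong (π m ⊕_) (⊕-assoc 1# (⊖ 1#) (⊖ π n)) ⟩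
    π m ⊕ (1# ⊕ (⊖ 1# ⊕ ⊖ π n))         ≡⟨ ⊕-assoc (π m) 1# _ ⟨
    π m ⊕ 1# ⊕ (⊖ 1# ⊕ ⊖ π n)           ≡⟨ cong₂ _⊕_ (⊕-comm (π m) 1#) (-‿+-comm 1# (π n)) ⟩
    1# ⊕ π m ⊕ ⊖ (1# ⊕ π n)             ≡⟨ cong₂ (λ x y → x ⊕ ⊖ y) (π-+ 1 m) (π-+ 1 n) ⟨
    π (suc m) ⊕ ⊖ π (suc n)             ∎
    where open ≡-Reasoning

  πℤ-+ : ∀ i j → πℤ (i ℤ.+ j) ≡ πℤ i ⊕ πℤ j
  πℤ-+ (+ m)    (+ n)    = π-+ m n
  πℤ-+ (+ m)    -[1+ n ] = πℤ-⊖ m (suc n)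
  πℤ-+ -[1+ m ] (+ n)    = trans (πℤ-⊖ n (suc m)) (⊕-comm (π n) _)
  πℤ-+ -[1+ m ] -[1+ n ] = trans
    (cong ⊖_ (trans (cong (λ k → π (suc k)) (sym (ℕ.+-suc m n))) (π-+ (suc m) (suc n))))
    (sym (-‿+-comm (π (suc m)) (π (suc n))))

  πℤ-pos-* : ∀ m n → πℤ (+ m ℤ.* + n) ≡ π m ⊗ π n
  πℤ-pos-* m n = trans (cong πℤ (sym (ℤ.pos-* m n))) (π-* m n)

  πℤ-* : ∀ i j → πℤ (i ℤ.* j) ≡ πℤ i ⊗ πℤ j
  πℤ-* (+ m) (+ n) = πℤ-pos-* m n
  πℤ-* (+ m) -[1+ n ] = begin
    πℤ (+ m ℤ.* -[1+ n ])            ≡⟨ cong πℤ (ℤ.neg-distribʳ-* (+ m) (+ suc n)) ⟨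
    πℤ (ℤ.- (+ m ℤ.* + suc n))       ≡⟨ πℤ-neg (+ m ℤ.* + suc n) ⟩
    ⊖ πℤ (+ m ℤ.* + suc n)           ≡⟨ cong ⊖_ (πℤ-pos-* m (suc n)) ⟩
    ⊖ (π m ⊗ π (suc n))              ≡⟨ -‿distribʳ-* (π m) (π (suc n)) ⟩
    π m ⊗ ⊖ π (suc n)                ∎
    where open ≡-Reasoning
  πℤ-* -[1+ m ] (+ n) = begin
    πℤ (-[1+ m ] ℤ.* + n)            ≡⟨ cong πℤ (ℤ.neg-distribˡ-* (+ suc m) (+ n)) ⟨
    πℤ (ℤ.- (+ suc m ℤ.* + n))       ≡⟨ πℤ-neg (+ suc m ℤ.* + n) ⟩
    ⊖ πℤ (+ suc m ℤ.* + n)           ≡⟨ cong ⊖_ (πℤ-pos-* (suc m) n) ⟩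
    ⊖ (π (suc m) ⊗ π n)              ≡⟨ -‿distribˡ-* (π (suc m)) (π n) ⟩
    ⊖ π (suc m) ⊗ π n                ∎
    where open ≡-Reasoning
  πℤ-* -[1+ m ] -[1+ n ] = begin
    π (suc m ℕ.* suc n)              ≡⟨ π-* (suc m) (suc n) ⟩
    π (suc m) ⊗ π (suc n)            ≡⟨ -‿involutive _ ⟨
    ⊖ ⊖ (π (suc m) ⊗ π (suc n))      ≡⟨ cong ⊖_ (-‿distribʳ-* (π (suc m)) (π (suc n))) ⟩
    ⊖ (π (suc m) ⊗ ⊖ π (suc n))      ≡⟨ -‿distribˡ-* (π (suc m)) (⊖ π (suc n)) ⟩
    ⊖ π (suc m) ⊗ ⊖ π (suc n)        ∎
    where open ≡-Reasoning

  almostCommutativeRing : AlmostCommutativeRing _ _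
  almostCommutativeRing = fromCommutativeRing commutativeRing

  -- Integer coefficients let the solver recognise cancelling terms, which it could not do
  -- with coefficients in F p for a variable p.
  πℤ-morphism : ℤ.+-*-rawRing -Raw-AlmostCommutative⟶ almostCommutativeRing
  πℤ-morphism = record
    { ⟦_⟧ = πℤ ; +-homo = πℤ-+ ; *-homo = πℤ-* ; -‿homo = πℤ-neg ; 0-homo = refl ; 1-homo = refl }

  πℤ-≟ : ∀ i j → Maybe (πℤ i ≡ πℤ j)
  πℤ-≟ i j with i ℤ.≟ j
  ... | yes i≡j = just (cong πℤ i≡j)
  ... | no _    = nothing

  module Solver = Algebra.Solver.Ring ℤ.+-*-rawRing almostCommutativeRing πℤ-morphism πℤ-≟

-- The field with p elements and its linear algebra.

module Geometry (p : ℕ) .{{_ : NonZero p}} (p-prime : Prime p) where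

  open Residues p
  open Solver using (solve; _:=_; _:+_; _:*_; _:-_; :-_; con)

  1≢0 : 1# ≢ 0#
  1≢0 1≡0 = ℕ.1+n≢0 (begin
    1      ≡⟨ m<n⇒m%n≡m 1<p ⟨
    1 % p  ≡⟨ toℕ-π 1 ⟨
    toℕ 1# ≡⟨ cong toℕ 1≡0 ⟩
    toℕ 0# ≡⟨ toℕ-π 0 ⟩
    0 % p  ≡⟨ m<n⇒m%n≡m (ℕ.<-trans (ℕ.s≤s ℕ.z≤n) 1<p) ⟩
    0      ∎)
    where
    open ≡-Reasoning
    1<p : 1 ℕ.< p
    1<p = nonTrivial⇒n>1 p {{prime⇒nonTrivial p-prime}}

  ⊗-zeroʳ : ∀ a → a ⊗ 0# ≡ 0#
  ⊗-zeroʳ = solve 1 (λ a → a :* con 0ℤ := con 0ℤ) refl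

  π-multiple : ∀ m → π (m ℕ.* p) ≡ 0#
  π-multiple m = trans (π-* m p) (trans (cong (π m ⊗_) π-p) (⊗-zeroʳ (π m)))

  opaque

    -- Bézout for the coprime numbers p and `toℕ a`. The identity over ℕ comes in two signs: 1 + y n
    -- = x p makes -y the inverse, and 1 + x p = y n makes it y.
    inverse : ∀ a → a ≢ 0# → ∃ λ b → b ⊗ a ≡ 1#
    inverse a a≢0 = from-Bézout (coprime-Bézout (prime⇒coprime p-prime {{≢-nonZero n≢0}} (toℕ<n a)))
      where
      open ≡-Reasoning
      n : ℕ
      n = toℕ a
      n≢0 : n ≢ 0
      n≢0 n≡0 = a≢0 (trans (sym (π-toℕ a)) (cong π n≡0))
      times : ∀ y → π (y ℕ.* n) ≡ π y ⊗ a
      times y = trans (π-* y n) (cong (π y ⊗_) (π-toℕ a))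
      from-Bézout : Bézout.Identity 1 p n → ∃ λ b → b ⊗ a ≡ 1#
      from-Bézout (Bézout.+- x y eq) = ⊖ π y , (begin
        ⊖ π y ⊗ a                    ≡⟨ solve 2 (λ y a → :- y :* a := con 1ℤ :- (con 1ℤ :+ y :* a)) refl (π y) a ⟩
        1# ⊕ ⊖ (1# ⊕ π y ⊗ a)        ≡⟨ cong (λ z → 1# ⊕ ⊖ (1# ⊕ z)) (times y) ⟨
        1# ⊕ ⊖ (1# ⊕ π (y ℕ.* n))    ≡⟨ cong (λ z → 1# ⊕ ⊖ z) (π-+ 1 (y ℕ.* n)) ⟨
        1# ⊕ ⊖ π (1 ℕ.+ y ℕ.* n)     ≡⟨ cong (λ z → 1# ⊕ ⊖ z) (trans (cong π eq) (π-multiple x)) ⟩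
        1# ⊕ ⊖ 0#                    ≡⟨ solve 0 (con 1ℤ :- con 0ℤ := con 1ℤ) refl ⟩
        1#                           ∎)
      from-Bézout (Bézout.-+ x y eq) = π y , (begin
        π y ⊗ a                      ≡⟨ times y ⟨
        π (y ℕ.* n)                  ≡⟨ cong π eq ⟨
        π (1 ℕ.+ x ℕ.* p)            ≡⟨ π-+ 1 (x ℕ.* p) ⟩
        1# ⊕ π (x ℕ.* p)             ≡⟨ cong (1# ⊕_) (π-multiple x) ⟩
        1# ⊕ 0#                      ≡⟨ solve 0 (con 1ℤ :+ con 0ℤ := con 1ℤ) refl ⟩
        1#                           ∎)

  ⊗-cancelˡ-zero : ∀ a {b} → a ≢ 0# → a ⊗ b ≡ 0# → b ≡ 0#
  ⊗-cancelˡ-zero a {b} a≢0 ab≡0 with inverse a a≢0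
  ... | c , ca≡1 = begin
    b           ≡⟨ ⊗-identityˡ b ⟨
    1# ⊗ b      ≡⟨ cong (_⊗ b) ca≡1 ⟨
    c ⊗ a ⊗ b   ≡⟨ ⊗-assoc c a b ⟩
    c ⊗ (a ⊗ b) ≡⟨ cong (c ⊗_) ab≡0 ⟩
    c ⊗ 0#      ≡⟨ ⊗-zeroʳ c ⟩
    0#          ∎
    where open ≡-Reasoning

  -- Linear algebra in the plane

  infixl 6 _+ₚ_
  infixr 7 _·_

  0ₚ : Pt p
  0ₚ = origin p

  _+ₚ_ : Pt p → Pt p → Pt p
  (x₁ , x₂) +ₚ (y₁ , y₂) = x₁ ⊕ y₁ , x₂ ⊕ y₂

  _·_ : F p → Pt p → Pt p
  t · (x₁ , x₂) = t ⊗ x₁ , t ⊗ x₂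

  det : Pt p → Pt p → F p
  det (x₁ , x₂) (y₁ , y₂) = x₁ ⊗ y₂ ⊕ ⊖ (x₂ ⊗ y₁)

  scale≡· : ∀ t v → scale p t v ≡ t · v
  scale≡· t (v₁ , v₂) = cong₂ _,_ (π-⊗ t v₁) (π-⊗ t v₂)

  ·-identity : ∀ v → 1# · v ≡ v
  ·-identity (v₁ , v₂) = cong₂ _,_ (⊗-identityˡ v₁) (⊗-identityˡ v₂)

  ·-assoc : ∀ s t v → (s ⊗ t) · v ≡ s · t · v
  ·-assoc s t (v₁ , v₂) = cong₂ _,_ (⊗-assoc s t v₁) (⊗-assoc s t v₂)

  ·-zeroˡ : ∀ v → 0# · v ≡ 0ₚ
  ·-zeroˡ (v₁ , v₂) = cong₂ _,_ (zeroˡ v₁) (zeroˡ v₂)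
    where zeroˡ = solve 1 (λ a → con 0ℤ :* a := con 0ℤ) refl

  det-zeroˡ : ∀ v → det 0ₚ v ≡ 0#
  det-zeroˡ (v₁ , v₂) = solve 2 (λ a b → con 0ℤ :* b :- con 0ℤ :* a := con 0ℤ) refl v₁ v₂

  opaque

    -- Completes a nonzero vector to a basis of determinant 1. The witness inverts whichever
    -- coordinate is nonzero.
    det-dual : ∀ v → v ≢ 0ₚ → ∃ λ w → det v w ≡ 1#
    det-dual (v₁ , v₂) v≢0 with v₁ ≟ᶠ 0#
    ... | no v₁≢0 with inverse v₁ v₁≢0
    ...   | c , cv₁≡1 = (0# , c) ,
      trans (solve 3 (λ a b c → a :* c :- b :* con 0ℤ := c :* a) refl v₁ v₂ c) cv₁≡1
    det-dual (v₁ , v₂) v≢0 | yes v₁≡0 with inverse v₂ (λ v₂≡0 → v≢0 (cong₂ _,_ v₁≡0 v₂≡0))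
    ...   | c , cv₂≡1 = (⊖ c , 0#) ,
      trans (solve 3 (λ a b c → a :* con 0ℤ :- b :* (:- c) := c :* b) refl v₁ v₂ c) cv₂≡1

  -- The linear relation among three vectors of a plane, in a form free of division.
  cramer : ∀ x y v → det x y · v ≡ det v y · x +ₚ det x v · y
  cramer (x₁ , x₂) (y₁ , y₂) (v₁ , v₂) = cong₂ _,_
    (solve 6 (λ x₁ x₂ y₁ y₂ v₁ v₂ → (x₁ :* y₂ :- x₂ :* y₁) :* v₁ :=
      (v₁ :* y₂ :- v₂ :* y₁) :* x₁ :+ (x₁ :* v₂ :- x₂ :* v₁) :* y₁) refl x₁ x₂ y₁ y₂ v₁ v₂)
    (solve 6 (λ x₁ x₂ y₁ y₂ v₁ v₂ → (x₁ :* y₂ :- x₂ :* y₁) :* v₂ :=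
      (v₁ :* y₂ :- v₂ :* y₁) :* x₂ :+ (x₁ :* v₂ :- x₂ :* v₁) :* y₂) refl x₁ x₂ y₁ y₂ v₁ v₂)

  expand-in-basis : ∀ {x y} → det x y ≡ 1# → ∀ v → v ≡ det v y · x +ₚ det x v · y
  expand-in-basis {x} {y} xy≡1 v = begin
    v                         ≡⟨ ·-identity v ⟨
    1# · v                    ≡⟨ cong (_· v) xy≡1 ⟨
    det x y · v               ≡⟨ cramer x y v ⟩
    det v y · x +ₚ det x v · y ∎
    where open ≡-Reasoning

  opaque

    -- In the basis formed by `x` and its dual `w`, the `w`-coordinate of `y` is `det x y`.
    parallel : ∀ {x y} → x ≢ 0ₚ → det x y ≡ 0# → ∃ λ t → y ≡ t · x
    parallel {x} {y} x≢0 xy≡0 with det-dual x x≢0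
    ... | w , xw≡1 = det y w , (begin
      y                           ≡⟨ expand-in-basis xw≡1 y ⟩
      det y w · x +ₚ det x y · w  ≡⟨ cong (λ z → det y w · x +ₚ z · w) xy≡0 ⟩
      det y w · x +ₚ 0# · w       ≡⟨ cong₂ _,_ (drop _ (proj₁ w)) (drop _ (proj₂ w)) ⟩
      det y w · x                 ∎)
      where
      open ≡-Reasoning
      drop : ∀ a b → a ⊕ 0# ⊗ b ≡ a
      drop = solve 2 (λ a b → a :+ con 0ℤ :* b := a) refl

  -- The symplectic form on F p ⁴, whose zeros are the solutions of det x x′ = det y y′

  V : Set
  V = Pt p × Pt p

  infixl 6 _+ᵥ_
  infixr 7 _·ᵥ_

  _≟ᵥ_ : DecidableEquality V
  _≟ᵥ_ = ≡-dec _≟ₚ_ _≟ₚ_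

  _+ᵥ_ : V → V → V
  (x , y) +ᵥ (x′ , y′) = x +ₚ x′ , y +ₚ y′

  _·ᵥ_ : F p → V → V
  t ·ᵥ (x , y) = t · x , t · y

  ⟨_,_⟩ : V → V → F p
  ⟨ (x , y) , (x′ , y′) ⟩ = det x x′ ⊕ ⊖ det y y′

  ·ᵥ-assoc : ∀ s t v → (s ⊗ t) ·ᵥ v ≡ s ·ᵥ t ·ᵥ v
  ·ᵥ-assoc s t (x , y) = cong₂ _,_ (·-assoc s t x) (·-assoc s t y)

  ·ᵥ-identity : ∀ v → 1# ·ᵥ v ≡ v
  ·ᵥ-identity (x , y) = cong₂ _,_ (·-identity x) (·-identity y)

  +ᵥ-cancel : ∀ s w v → (v +ᵥ s ·ᵥ w) +ᵥ (⊖ s) ·ᵥ w ≡ v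
  +ᵥ-cancel s ((a , b) , (c , d)) ((a′ , b′) , (c′ , d′)) =
    cong₂ _,_ (cong₂ _,_ (cancel s a a′) (cancel s b b′)) (cong₂ _,_ (cancel s c c′) (cancel s d d′))
    where
    cancel : ∀ s a b → b ⊕ s ⊗ a ⊕ ⊖ s ⊗ a ≡ b
    cancel = solve 3 (λ s a b → b :+ s :* a :+ :- s :* a := b) refl

  det-+· : ∀ x y s z → det x (y +ₚ s · z) ≡ det x y ⊕ s ⊗ det x z
  det-+· (x₁ , x₂) (y₁ , y₂) s (z₁ , z₂) = solve 7 (λ x₁ x₂ y₁ y₂ s z₁ z₂ →
    x₁ :* (y₂ :+ s :* z₂) :- x₂ :* (y₁ :+ s :* z₁) :=
    (x₁ :* y₂ :- x₂ :* y₁) :+ s :* (x₁ :* z₂ :- x₂ :* z₁)) refl x₁ x₂ y₁ y₂ s z₁ z₂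

  det-· : ∀ t x y → det x (t · y) ≡ t ⊗ det x y
  det-· t (x₁ , x₂) (y₁ , y₂) = solve 5 (λ t x₁ x₂ y₁ y₂ →
    x₁ :* (t :* y₂) :- x₂ :* (t :* y₁) := t :* (x₁ :* y₂ :- x₂ :* y₁)) refl t x₁ x₂ y₁ y₂

  det-+·ˡ : ∀ x s z y → det (x +ₚ s · z) y ≡ det x y ⊕ s ⊗ det z y
  det-+·ˡ (x₁ , x₂) s (z₁ , z₂) (y₁ , y₂) = solve 7 (λ x₁ x₂ s z₁ z₂ y₁ y₂ →
    (x₁ :+ s :* z₁) :* y₂ :- (x₂ :+ s :* z₂) :* y₁ :=
    (x₁ :* y₂ :- x₂ :* y₁) :+ s :* (z₁ :* y₂ :- z₂ :* y₁)) refl x₁ x₂ s z₁ z₂ y₁ y₂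

  det-·ˡ : ∀ t x y → det (t · x) y ≡ t ⊗ det x y
  det-·ˡ t (x₁ , x₂) (y₁ , y₂) = solve 5 (λ t x₁ x₂ y₁ y₂ →
    (t :* x₁) :* y₂ :- (t :* x₂) :* y₁ := t :* (x₁ :* y₂ :- x₂ :* y₁)) refl t x₁ x₂ y₁ y₂

  det-antisym : ∀ x y → det x y ≡ ⊖ det y x
  det-antisym (x₁ , x₂) (y₁ , y₂) = solve 4 (λ x₁ x₂ y₁ y₂ →
    x₁ :* y₂ :- x₂ :* y₁ := :- (y₁ :* x₂ :- y₂ :* x₁)) refl x₁ x₂ y₁ y₂

  det-self : ∀ x → det x x ≡ 0#
  det-self (x₁ , x₂) = solve 2 (λ x₁ x₂ → x₁ :* x₂ :- x₂ :* x₁ := con 0ℤ) refl x₁ x₂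

  form-+· : ∀ u v s w → ⟨ u , v +ᵥ s ·ᵥ w ⟩ ≡ ⟨ u , v ⟩ ⊕ s ⊗ ⟨ u , w ⟩
  form-+· (x , y) (x′ , y′) s (x″ , y″) =
    trans (cong₂ (λ a b → a ⊕ ⊖ b) (det-+· x x′ s x″) (det-+· y y′ s y″))
      (solve 5 (λ a b s c d → (a :+ s :* b) :- (c :+ s :* d) := (a :- c) :+ s :* (b :- d)) refl
        (det x x′) (det x x″) s (det y y′) (det y y″))

  form-· : ∀ t u v → ⟨ u , t ·ᵥ v ⟩ ≡ t ⊗ ⟨ u , v ⟩
  form-· t (x , y) (x′ , y′) = trans (cong₂ (λ a b → a ⊕ ⊖ b) (det-· t x x′) (det-· t y y′))
    (solve 3 (λ t a b → t :* a :- t :* b := t :* (a :- b)) refl t (det x x′) (det y y′))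

  form-·ˡ : ∀ t u v → ⟨ t ·ᵥ u , v ⟩ ≡ t ⊗ ⟨ u , v ⟩
  form-·ˡ t (x , y) (x′ , y′) = trans (cong₂ (λ a b → a ⊕ ⊖ b) (det-·ˡ t x x′) (det-·ˡ t y y′))
    (solve 3 (λ t a b → t :* a :- t :* b := t :* (a :- b)) refl t (det x x′) (det y y′))

  form-antisym : ∀ u v → ⟨ u , v ⟩ ≡ ⊖ ⟨ v , u ⟩
  form-antisym (x , y) (x′ , y′) =
    trans (cong₂ (λ a b → a ⊕ ⊖ b) (det-antisym x x′) (det-antisym y y′))
      (solve 2 (λ a b → :- a :- :- b := :- (a :- b)) refl (det x′ x) (det y′ y))

  -- A separating `w` is a direction of translation that moves ⟨ u , _ ⟩ through all scalars and
  -- leaves ⟨ u′ , _ ⟩ unchanged.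
  Separated Proportional : V → V → Set
  Separated u u′    = ∃ λ w → ⟨ u , w ⟩ ≡ 1# × ⟨ u′ , w ⟩ ≡ 0#
  Proportional u u′ = ∃ λ t → t ≢ 0# × u′ ≡ t ·ᵥ u

  separate : ∀ u u′ w → ⟨ u , w ⟩ ≢ 0# → ⟨ u′ , w ⟩ ≡ 0# → Separated u u′
  separate u u′ w uw≢0 u′w≡0 with inverse ⟨ u , w ⟩ uw≢0
  ... | c , c≡ = c ·ᵥ w , trans (form-· c u w) c≡ ,
    trans (form-· c u′ w) (trans (cong (c ⊗_) u′w≡0) (⊗-zeroʳ c))

  ≢0-≡⊖ : ∀ {a b} → a ≡ ⊖ b → b ≢ 0# → a ≢ 0#
  ≢0-≡⊖ {a} {b} a≡-b b≢0 a≡0 = b≢0 (begin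
    b      ≡⟨ solve 1 (λ b → b := :- :- b) refl b ⟩
    ⊖ ⊖ b  ≡⟨ cong ⊖_ a≡-b ⟨
    ⊖ a    ≡⟨ cong ⊖_ a≡0 ⟩
    ⊖ 0#   ≡⟨ solve 0 (:- con 0ℤ := con 0ℤ) refl ⟩
    0#     ∎)
    where open ≡-Reasoning

  difference≢0 : ∀ t x x′ → x′ ≢ t · x → x′ +ₚ (⊖ t) · x ≢ 0ₚ
  difference≢0 t x x′ x′≢tx z≡0 = x′≢tx
    (cong₂ _,_ (shift (proj₁ x′) (proj₁ x) (cong proj₁ z≡0))
               (shift (proj₂ x′) (proj₂ x) (cong proj₂ z≡0)))
    where
    shift : ∀ a b → a ⊕ ⊖ t ⊗ b ≡ 0# → a ≡ t ⊗ b
    shift a b eq = trans (solve 3 (λ a t b → a := (a :+ :- t :* b) :+ t :* b) refl a t b)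
      (trans (cong (_⊕ t ⊗ b) eq) (⊕-identityˡ _))

  -- The vector `(0ₚ , y′)` is orthogonal to `(x′ , y′)` because `det y′ y′` vanishes, and it pairs
  -- with `(x , y)` to `⊖ det y y′`.
  separated-transverse : ∀ x y x′ y′ → det y y′ ≢ 0# → Separated (x , y) (x′ , y′)
  separated-transverse x y x′ y′ yy′≢0 = separate (x , y) (x′ , y′) (0ₚ , y′)
    (≢0-≡⊖ (form-0ₚ x y) yy′≢0)
    (trans (form-0ₚ x′ y′) (trans (cong ⊖_ (det-self y′)) (solve 0 (:- con 0ℤ := con 0ℤ) refl)))
    where
    form-0ₚ : ∀ x y → ⟨ (x , y) , (0ₚ , y′) ⟩ ≡ ⊖ det y y′
    form-0ₚ (x₁ , x₂) y =
      solve 3 (λ x₁ x₂ a → (x₁ :* con 0ℤ :- x₂ :* con 0ℤ) :- a := :- a) refl x₁ x₂ (det y y′)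

  opaque

    -- Separation from `(0ₚ , y′)`, with `y′` dual to `y`, already contains the required `w`.
    nondegenerate : ∀ x y → y ≢ 0ₚ → ∃ λ w → ⟨ (x , y) , w ⟩ ≡ 1#
    nondegenerate x y y≢0 = case det-dual y y≢0 of λ where
      (y′ , yy′≡1) → case separated-transverse x y 0ₚ y′ (λ yy′≡0 → 1≢0 (trans (sym yy′≡1) yy′≡0)) of λ where
        (w , uw≡1 , _) → w , uw≡1

  -- When the second halves are `y` and `t · y`, the combination u′ - t u has second half zero, so
  -- its pairing sees only `w₁`.
  form-difference : ∀ t x x′ y w₁ w₂ → det (x′ +ₚ (⊖ t) · x) w₁ ≡
    ⟨ (x′ , t · y) , (w₁ , w₂) ⟩ ⊕ ⊖ (t ⊗ ⟨ (x , y) , (w₁ , w₂) ⟩)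
  form-difference t x x′ y w₁ w₂ = begin
    det (x′ +ₚ (⊖ t) · x) w₁              ≡⟨ det-+·ˡ x′ (⊖ t) x w₁ ⟩
    det x′ w₁ ⊕ ⊖ t ⊗ det x w₁
      ≡⟨ solve 4 (λ a t b c → a :+ :- t :* b := (a :- t :* c) :- t :* (b :- c)) refl
           (det x′ w₁) t (det x w₁) (det y w₂) ⟩
    det x′ w₁ ⊕ ⊖ (t ⊗ det y w₂) ⊕ ⊖ (t ⊗ ⟨ (x , y) , (w₁ , w₂) ⟩)
      ≡⟨ cong (λ z → det x′ w₁ ⊕ ⊖ z ⊕ ⊖ (t ⊗ ⟨ (x , y) , (w₁ , w₂) ⟩)) (det-·ˡ t y w₂) ⟨
    ⟨ (x′ , t · y) , (w₁ , w₂) ⟩ ⊕ ⊖ (t ⊗ ⟨ (x , y) , (w₁ , w₂) ⟩) ∎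
    where open ≡-Reasoning

  -- The second half of `w` is scaled so that it cancels `det x′ w₁` in the pairing with u′. If u
  -- were orthogonal to `w` as well, so would be u′ - t u, whose pairing is 1.
  separated-parallel : ∀ t x y x′ w₁ w₂ → det (x′ +ₚ (⊖ t) · x) w₁ ≡ 1# → det (t · y) w₂ ≡ 1# →
    Separated (x , y) (x′ , t · y)
  separated-parallel t x y x′ w₁ w₂ zw₁≡1 y′w₂≡1 = separate (x , y) (x′ , t · y) w uw≢0 u′w≡0
    where
    open ≡-Reasoning
    w : V
    w = w₁ , det x′ w₁ · w₂
    u′w≡0 : ⟨ (x′ , t · y) , w ⟩ ≡ 0#
    u′w≡0 = begin
      det x′ w₁ ⊕ ⊖ det (t · y) (det x′ w₁ · w₂) ≡⟨ cong (λ z → det x′ w₁ ⊕ ⊖ z) (det-· (det x′ w₁) (t · y) w₂) ⟩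
      det x′ w₁ ⊕ ⊖ (det x′ w₁ ⊗ det (t · y) w₂) ≡⟨ cong (λ z → det x′ w₁ ⊕ ⊖ (det x′ w₁ ⊗ z)) (y′w₂≡1) ⟩
      det x′ w₁ ⊕ ⊖ (det x′ w₁ ⊗ 1#)             ≡⟨ solve 1 (λ a → a :- a :* con 1ℤ := con 0ℤ) refl (det x′ w₁) ⟩
      0#                                         ∎
    uw≢0 : ⟨ (x , y) , w ⟩ ≢ 0#
    uw≢0 uw≡0 = 1≢0 (begin
      1#                                                 ≡⟨ zw₁≡1 ⟨
      det (x′ +ₚ (⊖ t) · x) w₁                           ≡⟨ form-difference t x x′ y w₁ (det x′ w₁ · w₂) ⟩
      ⟨ (x′ , t · y) , w ⟩ ⊕ ⊖ (t ⊗ ⟨ (x , y) , w ⟩)     ≡⟨ cong₂ (λ a b → a ⊕ ⊖ (t ⊗ b)) u′w≡0 uw≡0 ⟩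
      0# ⊕ ⊖ (t ⊗ 0#)                                    ≡⟨ solve 1 (λ t → con 0ℤ :- t :* con 0ℤ := con 0ℤ) refl t ⟩
      0#                                                 ∎)

  opaque

    -- If `y` and `y′` are independent, `separated-transverse` applies. Otherwise y′ = t y, and
    -- everything depends on whether x′ = t x with the same `t`, which is nonzero because `y′` is.
    proportional-or-separated : ∀ x y x′ y′ → y ≢ 0ₚ → y′ ≢ 0ₚ →
      Proportional (x , y) (x′ , y′) ⊎ Separated (x , y) (x′ , y′)
    proportional-or-separated x y x′ y′ y≢0 y′≢0 = case det y y′ ≟ᶠ 0# of λ where
      (no yy′≢0)  → inj₂ (separated-transverse x y x′ y′ yy′≢0)
      (yes yy′≡0) → case parallel y≢0 yy′≡0 of λ where
        (t , refl) → case x′ ≟ₚ (t · x) of λ where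
          (yes refl)  → inj₁ (t , (λ { refl → y′≢0 (·-zeroˡ y) }) , refl)
          (no x′≢tx)  → 
            case det-dual (x′ +ₚ (⊖ t) · x) (difference≢0 t x x′ x′≢tx) , det-dual (t · y) y′≢0 of λ where
              ((w₁ , zw₁≡1) , (w₂ , y′w₂≡1)) → inj₂ (separated-parallel t x y x′ w₁ w₂ zw₁≡1 y′w₂≡1)

  -- Matrices

  infixr 7 _▹_

  _▹_ : Mat p → Pt p → Pt p
  (a , b , c , d) ▹ (y₁ , y₂) = a ⊗ y₁ ⊕ b ⊗ y₂ , c ⊗ y₁ ⊕ d ⊗ y₂

  act≡▹ : ∀ θ y → act p θ y ≡ θ ▹ y
  act≡▹ (a , b , c , d) (y₁ , y₂) = cong₂ _,_ (entry a b) (entry c d)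
    where
    entry : ∀ a b → π (toℕ a ℕ.* toℕ y₁ ℕ.+ toℕ b ℕ.* toℕ y₂) ≡ a ⊗ y₁ ⊕ b ⊗ y₂
    entry a b = trans (π-+ (toℕ a ℕ.* toℕ y₁) _) (cong₂ _⊕_ (π-⊗ a y₁) (π-⊗ b y₂))

  -- Multiplicativity of the determinant, with determinant 1 read off from `InSL2`.
  det-▹ : ∀ θ → InSL2 p θ → ∀ x y → det (θ ▹ x) (θ ▹ y) ≡ det x y
  det-▹ θ@(a , b , c , d) θ∈SL₂ x@(x₁ , x₂) y@(y₁ , y₂) = begin
    det (θ ▹ x) (θ ▹ y)
      ≡⟨ solve 8 (λ a b c d x₁ x₂ y₁ y₂ →
           (a :* x₁ :+ b :* x₂) :* (c :* y₁ :+ d :* y₂) :- (c :* x₁ :+ d :* x₂) :* (a :* y₁ :+ b :* y₂) :=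
           (a :* d :- b :* c) :* (x₁ :* y₂ :- x₂ :* y₁)) refl a b c d x₁ x₂ y₁ y₂ ⟩
    (a ⊗ d ⊕ ⊖ (b ⊗ c)) ⊗ det x y ≡⟨ cong (λ z → (z ⊕ ⊖ (b ⊗ c)) ⊗ det x y) ad≡bc+1 ⟩
    (b ⊗ c ⊕ 1# ⊕ ⊖ (b ⊗ c)) ⊗ det x y
      ≡⟨ solve 2 (λ z e → (z :+ con 1ℤ :- z) :* e := e) refl (b ⊗ c) (det x y) ⟩
    det x y ∎
    where
    open ≡-Reasoning
    ad≡bc+1 : a ⊗ d ≡ b ⊗ c ⊕ 1#
    ad≡bc+1 = begin
      a ⊗ d                         ≡⟨ π-⊗ a d ⟨
      π (toℕ a ℕ.* toℕ d)           ≡⟨ θ∈SL₂ ⟩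
      π (toℕ b ℕ.* toℕ c ℕ.+ 1)     ≡⟨ π-+ (toℕ b ℕ.* toℕ c) 1 ⟩
      π (toℕ b ℕ.* toℕ c) ⊕ 1#      ≡⟨ cong (_⊕ 1#) (π-⊗ b c) ⟩
      b ⊗ c ⊕ 1#                    ∎

  -- The matrix sending x to x′ and y to y′, provided that e is the inverse of det x y.
  sending : (e : F p) (x y x′ y′ : Pt p) → Mat p
  sending e (x₁ , x₂) (y₁ , y₂) (x′₁ , x′₂) (y′₁ , y′₂) =
    e ⊗ (y₂ ⊗ x′₁ ⊕ ⊖ (x₂ ⊗ y′₁)) , e ⊗ (x₁ ⊗ y′₁ ⊕ ⊖ (y₁ ⊗ x′₁)) ,
    e ⊗ (y₂ ⊗ x′₂ ⊕ ⊖ (x₂ ⊗ y′₂)) , e ⊗ (x₁ ⊗ y′₂ ⊕ ⊖ (y₁ ⊗ x′₂))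

  -- The matrix with columns θ x and θ y, times the inverse of the matrix with columns x and y, the
  -- latter written as `e` times the adjugate.
  sending-▹ : ∀ {e} x y → e ⊗ det x y ≡ 1# → ∀ θ → θ ≡ sending e x y (θ ▹ x) (θ ▹ y)
  sending-▹ {e} x@(x₁ , x₂) y@(y₁ , y₂) exy≡1 (a , b , c , d) =
    cong₂ _,_ (left a b) (cong₂ _,_ (right a b) (cong₂ _,_ (left c d) (right c d)))
    where
    scaled : ∀ a → a ≡ e ⊗ det x y ⊗ a
    scaled a = trans (sym (⊗-identityˡ a)) (cong (_⊗ a) (sym exy≡1))
    left : ∀ a b → a ≡ e ⊗ (y₂ ⊗ (a ⊗ x₁ ⊕ b ⊗ x₂) ⊕ ⊖ (x₂ ⊗ (a ⊗ y₁ ⊕ b ⊗ y₂)))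
    left a b = trans (scaled a) (solve 7 (λ e x₁ x₂ y₁ y₂ a b →
      e :* (x₁ :* y₂ :- x₂ :* y₁) :* a :=
      e :* (y₂ :* (a :* x₁ :+ b :* x₂) :- x₂ :* (a :* y₁ :+ b :* y₂))) refl e x₁ x₂ y₁ y₂ a b)
    right : ∀ a b → b ≡ e ⊗ (x₁ ⊗ (a ⊗ y₁ ⊕ b ⊗ y₂) ⊕ ⊖ (y₁ ⊗ (a ⊗ x₁ ⊕ b ⊗ x₂)))
    right a b = trans (scaled b) (solve 7 (λ e x₁ x₂ y₁ y₂ a b →
      e :* (x₁ :* y₂ :- x₂ :* y₁) :* b :=
      e :* (x₁ :* (a :* y₁ :+ b :* y₂) :- y₁ :* (a :* x₁ :+ b :* x₂))) refl e x₁ x₂ y₁ y₂ a b)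

  ▹-· : ∀ θ t y → θ ▹ (t · y) ≡ t · θ ▹ y
  ▹-· (a , b , c , d) t (y₁ , y₂) = cong₂ _,_ (entry a b) (entry c d)
    where
    entry : ∀ a b → a ⊗ (t ⊗ y₁) ⊕ b ⊗ (t ⊗ y₂) ≡ t ⊗ (a ⊗ y₁ ⊕ b ⊗ y₂)
    entry a b = solve 5 (λ a b t y₁ y₂ → a :* (t :* y₁) :+ b :* (t :* y₂) := t :* (a :* y₁ :+ b :* y₂))
      refl a b t y₁ y₂

-- The second moment that counts orthogonal pairs.

module SecondMoment (p : ℕ) .{{_ : NonZero p}} (p-prime : Prime p) where

  open ListSums
  open import Data.Integer using (_+_; _*_; -_; _-_; _≤_; +<+; Positive)
  open Residues p hiding (module Solver)
  open Geometry p p-prime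
  open Enumeration using (elements)
  module R = Residues.Solver p
  open +-*-Solver

  scalarsᴱ : Enumeration (F p)
  scalarsᴱ = record
    { _≟_ = _≟ᶠ_ ; elements = allFin p ; unique = Unique.allFin⁺ p ; complete = ∈-allFin }

  pointsᴱ : Enumeration (Pt p)
  pointsᴱ = scalarsᴱ ×ᴱ scalarsᴱ

  vectorsᴱ : Enumeration V
  vectorsᴱ = pointsᴱ ×ᴱ pointsᴱ

  scalars : List (F p)
  scalars = elements scalarsᴱ

  vectors : List V
  vectors = elements vectorsᴱ

  module Scalars = Enumeration scalarsᴱ
  module Vectors = Enumeration vectorsᴱ

  q : ℤ
  q = + p

  q-positive : Positive q
  q-positive = ℤ.positive (+<+ (ℕ.>-nonZero⁻¹ p))

  q-1-positive : Positive (q - 1ℤ)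
  q-1-positive = subst Positive (sym (trans (ℤ.m-n≡m⊖n p 1) (ℤ.⊖-≥ (ℕ.<⇒≤ 1<p))))
    (ℤ.positive (+<+ (ℕ.m<n⇒0<n∸m 1<p)))
    where
    1<p : 1 ℕ.< p
    1<p = nonTrivial⇒n>1 p {{prime⇒nonTrivial p-prime}}

  ∑-scalars-const : ∀ c → ∑[ _ ← scalars ] c ≡ q * c
  ∑-scalars-const c = trans (∑-const scalars c) (cong (λ n → + n * c) (length-tabulate {n = p} id))

  ∑-points-const : ∀ c → ∑[ _ ← elements pointsᴱ ] c ≡ q * (q * c)
  ∑-points-const c = trans (∑-cartesianProduct scalars scalars _)
    (trans (∑-cong scalars (λ _ → ∑-scalars-const c)) (∑-scalars-const (q * c)))

  ∑-vectors-const : ∀ c → ∑[ _ ← vectors ] c ≡ q * (q * (q * (q * c)))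
  ∑-vectors-const c = trans (∑-cartesianProduct (elements pointsᴱ) (elements pointsᴱ) _)
    (trans (∑-cong (elements pointsᴱ) (λ _ → ∑-points-const c)) (∑-points-const (q * (q * c))))

  ∑-𝟙≟0 : ∑[ s ← scalars ] 𝟙 (s ≟ᶠ 0#) ≡ 1ℤ
  ∑-𝟙≟0 = trans (∑-cong scalars (λ s → sym (ℤ.*-identityʳ _))) (Scalars.∑-δ (λ _ → 1ℤ) 0#)

  ∑-shift : ∀ (f : F p → ℤ) c → ∑[ s ← scalars ] f (c ⊕ s) ≡ ∑ scalars f
  ∑-shift f c = ∑-reindex scalarsᴱ scalarsᴱ (c ⊕_) (⊖ c ⊕_)
    (λ s → R.solve 2 (λ c s → R.:- c R.:+ (c R.:+ s) R.:= s) refl c s)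
    (λ s → R.solve 2 (λ c s → c R.:+ (R.:- c R.:+ s) R.:= s) refl c s) f

  -- K is the indicator of 0 with its mean removed, scaled by p.
  K : F p → ℤ
  K c = q * 𝟙 (c ≟ᶠ 0#) - 1ℤ

  -- `K` only sees whether its argument vanishes; invariance under nonzero scaling and under sign
  -- follows.
  K-cong-zero : ∀ {a b} → (a ≡ 0# → b ≡ 0#) → (b ≡ 0# → a ≡ 0#) → K a ≡ K b
  K-cong-zero {a} {b} f g = cong (λ z → q * z - 1ℤ) (𝟙-cong (a ≟ᶠ 0#) (b ≟ᶠ 0#) f g)

  K-⊗ : ∀ {t} → t ≢ 0# → ∀ a → K (t ⊗ a) ≡ K a
  K-⊗ {t} t≢0 a = K-cong-zero (⊗-cancelˡ-zero t t≢0)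
    (λ a≡0 → trans (cong (t ⊗_) a≡0) (⊗-zeroʳ t))

  K-⊖ : ∀ a → K (⊖ a) ≡ K a
  K-⊖ a = K-cong-zero
    (λ -a≡0 → trans (R.solve 1 (λ a → a R.:= R.:- R.:- a) refl a)
                (trans (cong ⊖_ -a≡0) ⊖0≡0))
    (λ a≡0 → trans (cong ⊖_ a≡0) ⊖0≡0)
    where
    ⊖0≡0 : ⊖ 0# ≡ 0#
    ⊖0≡0 = R.solve 0 (R.:- R.con 0ℤ R.:= R.con 0ℤ) refl

  -- `K`, its square and `ν` are all affine in the indicator of 0, which is idempotent, so one
  -- evaluation serves all three.
  ∑-affine-𝟙≟0 : ∀ a b → ∑[ s ← scalars ] (a * 𝟙 (s ≟ᶠ 0#) + b) ≡ a + q * b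
  ∑-affine-𝟙≟0 a b = begin
    ∑[ s ← scalars ] (a * 𝟙 (s ≟ᶠ 0#) + b)
      ≡⟨ ∑-+ scalars (λ s → a * 𝟙 (s ≟ᶠ 0#)) (λ _ → b) ⟩
    ∑[ s ← scalars ] (a * 𝟙 (s ≟ᶠ 0#)) + ∑[ _ ← scalars ] b
      ≡⟨ cong₂ _+_ (trans (∑-*ˡ a scalars (λ s → 𝟙 (s ≟ᶠ 0#))) (cong (a *_) ∑-𝟙≟0)) (∑-scalars-const b) ⟩
    a * 1ℤ + q * b ≡⟨ cong (_+ q * b) (ℤ.*-identityʳ a) ⟩
    a + q * b ∎
    where open ≡-Reasoning

  ∑-K : ∑ scalars K ≡ 0ℤ
  ∑-K = trans (∑-affine-𝟙≟0 q (- 1ℤ)) (solve 1 (λ q → q :+ q :* (:- con 1ℤ) := con 0ℤ) refl q)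

  ∑-K² : ∑[ s ← scalars ] (K s * K s) ≡ q * (q - 1ℤ)
  ∑-K² = begin
    ∑[ s ← scalars ] (K s * K s) ≡⟨ ∑-cong scalars (λ s → square (s ≟ᶠ 0#)) ⟩
    ∑[ s ← scalars ] ((q * q - + 2 * q) * 𝟙 (s ≟ᶠ 0#) + 1ℤ) ≡⟨ ∑-affine-𝟙≟0 (q * q - + 2 * q) 1ℤ ⟩
    q * q - + 2 * q + q * 1ℤ
      ≡⟨ solve 1 (λ q → q :* q :- con (+ 2) :* q :+ q :* con 1ℤ := q :* (q :- con 1ℤ)) refl q ⟩
    q * (q - 1ℤ) ∎
    where
    open ≡-Reasoning
    square : ∀ {A : Set} (A? : Dec A) →
      (q * 𝟙 A? - 1ℤ) * (q * 𝟙 A? - 1ℤ) ≡ (q * q - + 2 * q) * 𝟙 A? + 1ℤ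
    square (yes _) = solve 1 (λ q → (q :* con 1ℤ :- con 1ℤ) :* (q :* con 1ℤ :- con 1ℤ) :=
      (q :* q :- con (+ 2) :* q) :* con 1ℤ :+ con 1ℤ) refl q
    square (no _)  = solve 1 (λ q → (q :* con 0ℤ :- con 1ℤ) :* (q :* con 0ℤ :- con 1ℤ) :=
      (q :* q :- con (+ 2) :* q) :* con 0ℤ :+ con 1ℤ) refl q

  -- Proportionality and functions invariant under nonzero scaling.

  ν : F p → ℤ
  ν t = 𝟙 (¬? (t ≟ᶠ 0#))

  δ : V → V → ℤ
  δ u v = ∑[ t ← scalars ] (ν t * 𝟙 (v ≟ᵥ (t ·ᵥ u)))

  δ-nonneg : ∀ u v → 0ℤ ≤ δ u v
  δ-nonneg u v = ∑-nonneg scalars (λ t →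
    subst (0ℤ ≤_) (𝟙-× (¬? (t ≟ᶠ 0#)) (v ≟ᵥ (t ·ᵥ u))) (𝟙-nonneg (¬? (t ≟ᶠ 0#) ×-dec (v ≟ᵥ (t ·ᵥ u)))))

  ∑-ν : ∑ scalars ν ≡ q - 1ℤ
  ∑-ν = begin
    ∑ scalars ν                                   ≡⟨ ∑-cong scalars (λ t → complement (t ≟ᶠ 0#)) ⟩
    ∑[ t ← scalars ] (- 1ℤ * 𝟙 (t ≟ᶠ 0#) + 1ℤ)    ≡⟨ ∑-affine-𝟙≟0 (- 1ℤ) 1ℤ ⟩
    - 1ℤ + q * 1ℤ                                 ≡⟨ solve 1 (λ q → :- con 1ℤ :+ q :* con 1ℤ := q :- con 1ℤ) refl q ⟩
    q - 1ℤ                                        ∎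
    where
    open ≡-Reasoning
    complement : ∀ {A : Set} (A? : Dec A) → 𝟙 (¬? A?) ≡ - 1ℤ * 𝟙 A? + 1ℤ
    complement (yes _) = refl
    complement (no _)  = refl

  Homogeneous : (V → ℤ) → Set
  Homogeneous f = ∀ t u → t ≢ 0# → f (t ·ᵥ u) ≡ f u

  -- The weight `δ u` collects the multiples t u with t nonzero. There are q - 1 such t, and `f`
  -- takes the value `f u` at each.
  ∑-δ-homogeneous : ∀ f → Homogeneous f → ∀ u → ∑[ v ← vectors ] (δ u v * f v) ≡ (q - 1ℤ) * f u
  ∑-δ-homogeneous f hom u = begin
    ∑[ v ← vectors ] (δ u v * f v)
      ≡⟨ ∑-cong vectors (λ v → sym (∑-*ʳ (f v) scalars _)) ⟩
    ∑[ v ← vectors ] ∑[ t ← scalars ] (ν t * 𝟙 (v ≟ᵥ (t ·ᵥ u)) * f v)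
      ≡⟨ ∑-swap vectors scalars (λ v t → ν t * 𝟙 (v ≟ᵥ (t ·ᵥ u)) * f v) ⟩
    ∑[ t ← scalars ] ∑[ v ← vectors ] (ν t * 𝟙 (v ≟ᵥ (t ·ᵥ u)) * f v)
      ≡⟨ ∑-cong scalars (λ t → trans (∑-cong vectors (λ v → ℤ.*-assoc (ν t) _ (f v)))
           (trans (∑-*ˡ (ν t) vectors _) (cong (ν t *_) (Vectors.∑-δ f (t ·ᵥ u))))) ⟩
    ∑[ t ← scalars ] (ν t * f (t ·ᵥ u))
      ≡⟨ ∑-cong scalars (λ t → 𝟙-*-cong (¬? (t ≟ᶠ 0#)) (hom t u)) ⟩
    ∑[ t ← scalars ] (ν t * f u) ≡⟨ ∑-*ʳ (f u) scalars ν ⟩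
    ∑ scalars ν * f u ≡⟨ cong (_* f u) ∑-ν ⟩
    (q - 1ℤ) * f u ∎
    where open ≡-Reasoning

  K-homogeneous : ∀ u → Homogeneous (λ v → K ⟨ u , v ⟩)
  K-homogeneous u t v t≢0 = trans (cong K (form-· t u v)) (K-⊗ t≢0 ⟨ u , v ⟩)

  -- The substitution of t s for s preserves being nonzero and turns t v = (t s) u into v = s u.
  δ-homogeneous : ∀ u → Homogeneous (δ u)
  δ-homogeneous u t v t≢0 with inverse t t≢0
  ... | r , rt≡1 = begin
    ∑[ s ← scalars ] (ν s * 𝟙 ((t ·ᵥ v) ≟ᵥ (s ·ᵥ u)))
      ≡⟨ ∑-reindex scalarsᴱ scalarsᴱ (t ⊗_) (r ⊗_) (cancel rt≡1)
           (cancel (trans (⊗-comm t r) rt≡1)) (λ s → ν s * 𝟙 ((t ·ᵥ v) ≟ᵥ (s ·ᵥ u))) ⟨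
    ∑[ s ← scalars ] (ν (t ⊗ s) * 𝟙 ((t ·ᵥ v) ≟ᵥ ((t ⊗ s) ·ᵥ u)))
      ≡⟨ ∑-cong scalars (λ s → cong₂ _*_
           (𝟙-cong (¬? ((t ⊗ s) ≟ᶠ 0#)) (¬? (s ≟ᶠ 0#))
             (λ ts≢0 s≡0 → ts≢0 (trans (cong (t ⊗_) s≡0) (⊗-zeroʳ t)))
             (λ s≢0 ts≡0 → s≢0 (⊗-cancelˡ-zero t t≢0 ts≡0)))
           (𝟙-cong ((t ·ᵥ v) ≟ᵥ ((t ⊗ s) ·ᵥ u)) (v ≟ᵥ (s ·ᵥ u))
             (λ tv≡tsu → trans (sym (cancelᵥ v))
               (trans (cong (r ·ᵥ_) (trans tv≡tsu (·ᵥ-assoc t s u))) (cancelᵥ (s ·ᵥ u))))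
             (λ v≡su → trans (cong (t ·ᵥ_) v≡su) (sym (·ᵥ-assoc t s u))))) ⟩
    ∑[ s ← scalars ] (ν s * 𝟙 (v ≟ᵥ (s ·ᵥ u))) ∎
    where
    open ≡-Reasoning
    cancel : ∀ {a b} → a ⊗ b ≡ 1# → ∀ s → a ⊗ (b ⊗ s) ≡ s
    cancel {a} {b} ab≡1 s = trans (sym (⊗-assoc a b s)) (trans (cong (_⊗ s) ab≡1) (⊗-identityˡ s))
    cancelᵥ : ∀ v → r ·ᵥ (t ·ᵥ v) ≡ v
    cancelᵥ v = trans (sym (·ᵥ-assoc r t v)) (trans (cong (_·ᵥ v) rt≡1) (·ᵥ-identity v))

  -- Translation by s w permutes the vectors for each of the q values of s, so a sum over the whole
  -- space may be taken line by line in direction `w`.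
  ∑-average : ∀ w f → q * ∑ vectors f ≡ ∑[ v ← vectors ] ∑[ s ← scalars ] f (v +ᵥ s ·ᵥ w)
  ∑-average w f = begin
    q * ∑ vectors f ≡⟨ ∑-scalars-const (∑ vectors f) ⟨
    ∑[ _ ← scalars ] ∑ vectors f ≡⟨ ∑-cong scalars translate ⟨
    ∑[ s ← scalars ] ∑[ v ← vectors ] f (v +ᵥ s ·ᵥ w) ≡⟨ ∑-swap scalars vectors (λ s v → f (v +ᵥ s ·ᵥ w)) ⟩
    ∑[ v ← vectors ] ∑[ s ← scalars ] f (v +ᵥ s ·ᵥ w) ∎
    where
    open ≡-Reasoning
    translate : ∀ s → ∑[ v ← vectors ] f (v +ᵥ s ·ᵥ w) ≡ ∑ vectors f
    translate s = ∑-reindex vectorsᴱ vectorsᴱ (λ v → v +ᵥ s ·ᵥ w) (λ v → v +ᵥ (⊖ s) ·ᵥ w)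
      (+ᵥ-cancel s w)
      (λ v → trans (cong (λ t → v +ᵥ (⊖ s) ·ᵥ w +ᵥ t ·ᵥ w)
                (R.solve 1 (λ s → s R.:= R.:- R.:- s) refl s)) (+ᵥ-cancel (⊖ s) w v)) f

  -- Correlations between the rows of `K`.

  form-line : ∀ u v s w → ⟨ u , w ⟩ ≡ 1# → ⟨ u , v +ᵥ s ·ᵥ w ⟩ ≡ ⟨ u , v ⟩ ⊕ s
  form-line u v s w uw≡1 = trans (form-+· u v s w)
    (trans (cong (λ z → ⟨ u , v ⟩ ⊕ s ⊗ z) uw≡1)
      (R.solve 2 (λ a s → a R.:+ s R.:* R.con 1ℤ R.:= a R.:+ s) refl ⟨ u , v ⟩ s))

  form-line-const : ∀ u v s w → ⟨ u , w ⟩ ≡ 0# → ⟨ u , v +ᵥ s ·ᵥ w ⟩ ≡ ⟨ u , v ⟩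
  form-line-const u v s w uw≡0 = trans (form-+· u v s w)
    (trans (cong (λ z → ⟨ u , v ⟩ ⊕ s ⊗ z) uw≡0)
      (R.solve 2 (λ a s → a R.:+ s R.:* R.con 0ℤ R.:= a) refl ⟨ u , v ⟩ s))

  correlation : V → V → ℤ
  correlation u u′ = ∑[ v ← vectors ] (K ⟨ u , v ⟩ * K ⟨ u′ , v ⟩)

  -- On each line in direction `w` the second factor is constant and the first runs through all
  -- values of `K`, whose sum is 0.
  correlation-separated : ∀ u u′ → Separated u u′ → correlation u u′ ≡ 0ℤ
  correlation-separated u u′ (w , uw≡1 , u′w≡0) =
    ℤ.*-cancelˡ-≡ q _ _ (begin
    q * correlation u u′ ≡⟨ ∑-average w _ ⟩
    ∑[ v ← vectors ] ∑[ s ← scalars ] (K ⟨ u , v +ᵥ s ·ᵥ w ⟩ * K ⟨ u′ , v +ᵥ s ·ᵥ w ⟩)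
      ≡⟨ ∑-cong vectors (λ v → ∑-cong scalars (λ s → cong₂ (λ a b → K a * K b)
           (form-line u v s w uw≡1) (form-line-const u′ v s w u′w≡0))) ⟩
    ∑[ v ← vectors ] ∑[ s ← scalars ] (K (⟨ u , v ⟩ ⊕ s) * K ⟨ u′ , v ⟩)
      ≡⟨ ∑-cong vectors (λ v → trans (∑-*ʳ (K ⟨ u′ , v ⟩) scalars (λ s → K (⟨ u , v ⟩ ⊕ s)))
           (cong (_* K ⟨ u′ , v ⟩) (trans (∑-shift K ⟨ u , v ⟩) ∑-K))) ⟩
    ∑[ v ← vectors ] (0ℤ * K ⟨ u′ , v ⟩) ≡⟨ ∑-*ˡ 0ℤ vectors (λ v → K ⟨ u′ , v ⟩) ⟩
    0ℤ * ∑[ v ← vectors ] K ⟨ u′ , v ⟩ ≡⟨ ℤ.*-zeroˡ (∑[ v ← vectors ] K ⟨ u′ , v ⟩) ⟩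
    0ℤ ≡⟨ ℤ.*-zeroʳ q ⟨
    q * 0ℤ ∎)
    where open ≡-Reasoning

  δ-separated : ∀ u u′ → Separated u u′ → δ u u′ ≡ 0ℤ
  δ-separated u u′ (w , uw≡1 , u′w≡0) = trans
    (∑-cong scalars (λ t → vanish t (t ≟ᶠ 0#) (u′ ≟ᵥ (t ·ᵥ u)))) (∑-zero scalars)
    where
    vanish : ∀ t (t≟0 : Dec (t ≡ 0#)) (u′≟tu : Dec (u′ ≡ t ·ᵥ u)) → 𝟙 (¬? t≟0) * 𝟙 u′≟tu ≡ 0ℤ
    vanish t (yes _)  u′≟tu      = ℤ.*-zeroˡ (𝟙 u′≟tu)
    vanish t (no t≢0) (no _)     = refl
    vanish t (no t≢0) (yes refl) = contradiction (begin
      t              ≡⟨ R.solve 1 (λ t → t R.:= t R.:* R.con 1ℤ) refl t ⟩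
      t ⊗ 1#         ≡⟨ cong (t ⊗_) uw≡1 ⟨
      t ⊗ ⟨ u , w ⟩  ≡⟨ form-·ˡ t u w ⟨
      ⟨ t ·ᵥ u , w ⟩ ≡⟨ u′w≡0 ⟩
      0#             ∎) t≢0
      where open ≡-Reasoning

  -- On each line in direction `w` the square of `K` sums to q (q - 1). There are q⁴ base points,
  -- and one factor q is returned to the averaging.
  correlation-self : ∀ u w → ⟨ u , w ⟩ ≡ 1# → correlation u u ≡ q * (q * (q * (q * (q - 1ℤ))))
  correlation-self u w uw≡1 = ℤ.*-cancelˡ-≡ q _ _ (begin
    q * correlation u u ≡⟨ ∑-average w _ ⟩
    ∑[ v ← vectors ] ∑[ s ← scalars ] (K ⟨ u , v +ᵥ s ·ᵥ w ⟩ * K ⟨ u , v +ᵥ s ·ᵥ w ⟩)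
      ≡⟨ ∑-cong vectors (λ v → ∑-cong scalars (λ s →
           cong (λ a → K a * K a) (form-line u v s w uw≡1))) ⟩
    ∑[ v ← vectors ] ∑[ s ← scalars ] (K (⟨ u , v ⟩ ⊕ s) * K (⟨ u , v ⟩ ⊕ s))
      ≡⟨ ∑-cong vectors (λ v → trans (∑-shift (λ a → K a * K a) ⟨ u , v ⟩) ∑-K²) ⟩
    ∑[ _ ← vectors ] (q * (q - 1ℤ)) ≡⟨ ∑-vectors-const (q * (q - 1ℤ)) ⟩
    q * (q * (q * (q * (q * (q - 1ℤ))))) ∎)
    where open ≡-Reasoning

  correlation-proportional : ∀ u w t → ⟨ u , w ⟩ ≡ 1# → t ≢ 0# →
    correlation u (t ·ᵥ u) ≡ q * (q * (q * (q * (q - 1ℤ))))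
  correlation-proportional u w t uw≡1 t≢0 = trans
    (∑-cong vectors (λ v → cong (K ⟨ u , v ⟩ *_) (trans (cong K (form-·ˡ t u v)) (K-⊗ t≢0 ⟨ u , v ⟩))))
    (correlation-self u w uw≡1)

  -- Pairing with `w` reads off the scalar, so s u = t u forces s = t.
  δ-proportional : ∀ u w t → ⟨ u , w ⟩ ≡ 1# → t ≢ 0# → δ u (t ·ᵥ u) ≡ 1ℤ
  δ-proportional u w t uw≡1 t≢0 = begin
    ∑[ s ← scalars ] (ν s * 𝟙 ((t ·ᵥ u) ≟ᵥ (s ·ᵥ u)))
      ≡⟨ ∑-cong scalars (λ s → trans (ℤ.*-comm (ν s) _) (cong (_* ν s)
           (𝟙-cong ((t ·ᵥ u) ≟ᵥ (s ·ᵥ u)) (s ≟ᶠ t) (λ tu≡su → injective (sym tu≡su))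
             (λ s≡t → cong (_·ᵥ u) (sym s≡t))))) ⟩
    ∑[ s ← scalars ] (𝟙 (s ≟ᶠ t) * ν s) ≡⟨ Scalars.∑-δ ν t ⟩
    ν t ≡⟨ 𝟙-true (¬? (t ≟ᶠ 0#)) t≢0 ⟩
    1ℤ ∎
    where
    open ≡-Reasoning
    form-unit : ∀ s → ⟨ s ·ᵥ u , w ⟩ ≡ s
    form-unit s = trans (form-·ˡ s u w) (trans (cong (s ⊗_) uw≡1)
      (R.solve 1 (λ s → s R.:* R.con 1ℤ R.:= s) refl s))
    injective : ∀ {s} → s ·ᵥ u ≡ t ·ᵥ u → s ≡ t
    injective {s} su≡tu = trans (sym (form-unit s)) (trans (cong (λ v → ⟨ v , w ⟩) su≡tu) (form-unit t))

  correlation≡δ : ∀ u u′ → proj₂ u ≢ 0ₚ → proj₂ u′ ≢ 0ₚ →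
    correlation u u′ ≡ q * (q * (q * (q * (q - 1ℤ)))) * δ u u′
  correlation≡δ u@(x , y) u′@(x′ , y′) y≢0 y′≢0 with proportional-or-separated x y x′ y′ y≢0 y′≢0
  ... | inj₂ separated = begin
    correlation u u′ ≡⟨ correlation-separated u u′ separated ⟩
    0ℤ               ≡⟨ ℤ.*-zeroʳ c ⟨
    c * 0ℤ           ≡⟨ cong (c *_) (δ-separated u u′ separated) ⟨
    c * δ u u′       ∎
    where
    open ≡-Reasoning
    c : ℤ
    c = q * (q * (q * (q * (q - 1ℤ))))
  ... | inj₁ (t , t≢0 , refl) with nondegenerate x y y≢0
  ...   | w , uw≡1 = begin
    correlation u (t ·ᵥ u) ≡⟨ correlation-proportional u w t uw≡1 t≢0 ⟩
    c                      ≡⟨ ℤ.*-identityʳ c ⟨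
    c * 1ℤ                 ≡⟨ cong (c *_) (δ-proportional u w t uw≡1 t≢0) ⟨
    c * δ u (t ·ᵥ u)       ∎
    where
    open ≡-Reasoning
    c : ℤ
    c = q * (q * (q * (q * (q - 1ℤ))))

  -- With c in place of q², the Gram matrix would be (q - 1) ((q⁴ + c²) δ - 2 c K), which bounds the
  -- sum of `K` by (q⁴ + c²) / (2 c) times that of `δ`. The choice c = q² minimises this factor, at
  -- q².
  deviation : V → V → ℤ
  deviation u v = K ⟨ u , v ⟩ - q * q * δ u v

  ∑-deviation : ∀ u u′ → proj₂ u ≢ 0ₚ → proj₂ u′ ≢ 0ₚ →
    ∑[ v ← vectors ] (deviation u v * deviation u′ v) ≡
    + 2 * (q * (q * ((q - 1ℤ) * (q * q * δ u u′ - K ⟨ u , u′ ⟩))))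
  ∑-deviation u u′ y≢0 y′≢0 = begin
    ∑[ v ← vectors ] (deviation u v * deviation u′ v)
      ≡⟨ ∑-cong vectors (λ v → solve 5 (λ q k d k′ d′ →
           (k :- q :* q :* d) :* (k′ :- q :* q :* d′) :=
           k :* k′ :+ (:- (q :* q) :* (d :* k′) :+ (:- (q :* q) :* (d′ :* k) :+ q :* q :* (q :* q) :* (d′ :* d))))
           refl q (K ⟨ u , v ⟩) (δ u v) (K ⟨ u′ , v ⟩) (δ u′ v)) ⟩
    ∑[ v ← vectors ] (K ⟨ u , v ⟩ * K ⟨ u′ , v ⟩ + (- (q * q) * (δ u v * K ⟨ u′ , v ⟩) +
      (- (q * q) * (δ u′ v * K ⟨ u , v ⟩) + q * q * (q * q) * (δ u′ v * δ u v))))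
      ≡⟨ ∑-combination (- (q * q)) (- (q * q)) (q * q * (q * q))
           (λ v → K ⟨ u , v ⟩ * K ⟨ u′ , v ⟩) (λ v → δ u v * K ⟨ u′ , v ⟩)
           (λ v → δ u′ v * K ⟨ u , v ⟩) (λ v → δ u′ v * δ u v) ⟩
    correlation u u′ + (- (q * q) * ∑[ v ← vectors ] (δ u v * K ⟨ u′ , v ⟩) +
      (- (q * q) * ∑[ v ← vectors ] (δ u′ v * K ⟨ u , v ⟩) +
        q * q * (q * q) * ∑[ v ← vectors ] (δ u′ v * δ u v)))
      -- The two cross terms agree: the form is antisymmetric and `K` is even.
      ≡⟨ cong₂ _+_ (correlation≡δ u u′ y≢0 y′≢0) (cong₂ _+_
           (cong (- (q * q) *_) (trans (∑-δ-homogeneous _ (K-homogeneous u′) u)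
             (cong ((q - 1ℤ) *_) (trans (cong K (form-antisym u′ u)) (K-⊖ ⟨ u , u′ ⟩)))))
           (cong₂ _+_ (cong (- (q * q) *_) (∑-δ-homogeneous _ (K-homogeneous u) u′))
             (cong (q * q * (q * q) *_) (∑-δ-homogeneous _ (δ-homogeneous u) u′)))) ⟩
    q * (q * (q * (q * (q - 1ℤ)))) * δ u u′ + (- (q * q) * ((q - 1ℤ) * K ⟨ u , u′ ⟩) +
      (- (q * q) * ((q - 1ℤ) * K ⟨ u , u′ ⟩) + q * q * (q * q) * ((q - 1ℤ) * δ u u′)))
      ≡⟨ solve 3 (λ q d k → q :* (q :* (q :* (q :* (q :- con 1ℤ)))) :* d :+
           (:- (q :* q) :* ((q :- con 1ℤ) :* k) :+ (:- (q :* q) :* ((q :- con 1ℤ) :* k) :+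
             q :* q :* (q :* q) :* ((q :- con 1ℤ) :* d))) :=
           con (+ 2) :* (q :* (q :* ((q :- con 1ℤ) :* (q :* q :* d :- k))))) refl q (δ u u′) (K ⟨ u , u′ ⟩) ⟩
    + 2 * (q * (q * ((q - 1ℤ) * (q * q * δ u u′ - K ⟨ u , u′ ⟩)))) ∎
    where
    open ≡-Reasoning
    ∑-combination : ∀ a b c (f g h k : V → ℤ) →
      ∑[ v ← vectors ] (f v + (a * g v + (b * h v + c * k v))) ≡
      ∑ vectors f + (a * ∑ vectors g + (b * ∑ vectors h + c * ∑ vectors k))
    ∑-combination a b c f g h k = trans
      (∑-+ vectors f (λ v → a * g v + (b * h v + c * k v))) (cong (λ z → ∑ vectors f + z) (trans
      (∑-+ vectors (λ v → a * g v) (λ v → b * h v + c * k v)) (cong₂ _+_ (∑-*ˡ a vectors g) (trans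
      (∑-+ vectors (λ v → b * h v) (λ v → c * k v)) (cong₂ _+_ (∑-*ˡ b vectors h) (∑-*ˡ c vectors k))))))

  cancel-nonneg : ∀ c {z} → Positive c → 0ℤ ≤ c * z → 0ℤ ≤ z
  cancel-nonneg c {z} c>0 0≤cz =
    ℤ.*-cancelˡ-≤-pos 0ℤ z c {{c>0}} (subst (_≤ c * z) (sym (ℤ.*-zeroʳ c)) 0≤cz)

  -- Positive semidefiniteness of the Gram matrix of the deviations replaces the spectral gap
  -- of the point-hyperplane incidence graph.
  ∑-K≤∑-δ : ∀ (P : List V) → (∀ u → u ∈ P → proj₂ u ≢ 0ₚ) →
    ∑[ u ← P ] ∑[ u′ ← P ] K ⟨ u , u′ ⟩ ≤ q * q * ∑[ u ← P ] ∑[ u′ ← P ] δ u u′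
  ∑-K≤∑-δ P P≢0 = ℤ.0≤i-j⇒j≤i
    -- The Gram identity carries the factor 2 q² (q - 1), which is positive because p is at least 2.
    (cancel-nonneg (q - 1ℤ) q-1-positive (cancel-nonneg q q-positive (cancel-nonneg q q-positive
      (cancel-nonneg (+ 2) _ (subst (0ℤ ≤_) expand
        (∑-nonneg vectors (λ v → square-nonneg (∑[ u ← P ] deviation u v))))))))
    where
    open ≡-Reasoning
    linear : ∀ c (f g : V → V → ℤ) → ∑[ u ← P ] ∑[ u′ ← P ] (c * f u u′ - g u u′) ≡
      c * ∑[ u ← P ] ∑[ u′ ← P ] f u u′ - ∑[ u ← P ] ∑[ u′ ← P ] g u u′
    linear c f g = begin
      ∑[ u ← P ] ∑[ u′ ← P ] (c * f u u′ - g u u′)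
        ≡⟨ ∑-cong P (λ u → inner (f u) (g u)) ⟩
      ∑[ u ← P ] (c * ∑ P (f u) - ∑ P (g u))
        ≡⟨ inner (λ u → ∑ P (f u)) (λ u → ∑ P (g u)) ⟩
      c * ∑[ u ← P ] ∑ P (f u) - ∑[ u ← P ] ∑ P (g u) ∎
      where
      inner : ∀ (f g : V → ℤ) → ∑[ u ← P ] (c * f u - g u) ≡ c * ∑ P f - ∑ P g
      inner f g = begin
        ∑[ u ← P ] (c * f u - g u)         ≡⟨ ∑-cong P (λ u → cong (λ z → c * f u + z) (sym (ℤ.-1*i≡-i (g u)))) ⟩
        ∑[ u ← P ] (c * f u + - 1ℤ * g u)  ≡⟨ ∑-+ P (λ u → c * f u) (λ u → - 1ℤ * g u) ⟩
        ∑[ u ← P ] (c * f u) + ∑[ u ← P ] (- 1ℤ * g u)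
          ≡⟨ cong₂ _+_ (∑-*ˡ c P f) (trans (∑-*ˡ (- 1ℤ) P g) (ℤ.-1*i≡-i (∑ P g))) ⟩
        c * ∑ P f - ∑ P g ∎
    c : ℤ
    c = + 2 * (q * (q * (q - 1ℤ)))
    assoc : ∀ z → + 2 * (q * (q * ((q - 1ℤ) * z))) ≡ c * z
    assoc z = solve 2 (λ q z → con (+ 2) :* (q :* (q :* ((q :- con 1ℤ) :* z))) :=
      con (+ 2) :* (q :* (q :* (q :- con 1ℤ))) :* z) refl q z
    expand : ∑[ v ← vectors ] (∑[ u ← P ] deviation u v * ∑[ u ← P ] deviation u v) ≡
      + 2 * (q * (q * ((q - 1ℤ) * (q * q * ∑[ u ← P ] ∑[ u′ ← P ] δ u u′ - ∑[ u ← P ] ∑[ u′ ← P ] K ⟨ u , u′ ⟩))))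
    expand = begin
      ∑[ v ← vectors ] (∑[ u ← P ] deviation u v * ∑[ u ← P ] deviation u v)
        ≡⟨ ∑-cong vectors (λ v → ∑-*-∑ P P (λ u → deviation u v) (λ u → deviation u v)) ⟩
      ∑[ v ← vectors ] ∑[ u ← P ] ∑[ u′ ← P ] (deviation u v * deviation u′ v)
        ≡⟨ ∑-swap vectors P (λ v u → ∑[ u′ ← P ] (deviation u v * deviation u′ v)) ⟩
      ∑[ u ← P ] ∑[ v ← vectors ] ∑[ u′ ← P ] (deviation u v * deviation u′ v)
        ≡⟨ ∑-cong P (λ u → ∑-swap vectors P (λ v u′ → deviation u v * deviation u′ v)) ⟩
      ∑[ u ← P ] ∑[ u′ ← P ] ∑[ v ← vectors ] (deviation u v * deviation u′ v)
        ≡⟨ ∑-cong-∈ P (λ u u∈P → ∑-cong-∈ P (λ u′ u′∈P →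
             trans (∑-deviation u u′ (P≢0 u u∈P) (P≢0 u′ u′∈P)) (assoc _))) ⟩
      ∑[ u ← P ] ∑[ u′ ← P ] (c * (q * q * δ u u′ - K ⟨ u , u′ ⟩))
        ≡⟨ trans (∑-cong P (λ u → ∑-*ˡ c P _)) (∑-*ˡ c P _) ⟩
      c * ∑[ u ← P ] ∑[ u′ ← P ] (q * q * δ u u′ - K ⟨ u , u′ ⟩)
        ≡⟨ cong (c *_) (linear (q * q) δ (λ u u′ → K ⟨ u , u′ ⟩)) ⟩
      c * (q * q * ∑[ u ← P ] ∑[ u′ ← P ] δ u u′ - ∑[ u ← P ] ∑[ u′ ← P ] K ⟨ u , u′ ⟩)
        ≡⟨ assoc _ ⟨
      + 2 * (q * (q * ((q - 1ℤ) * (q * q * ∑[ u ← P ] ∑[ u′ ← P ] δ u u′ - ∑[ u ← P ] ∑[ u′ ← P ] K ⟨ u , u′ ⟩)))) ∎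

  -- By definition of `K`, q times the indicator of 0 is 1 + K. The 1 yields the main term, as if
  -- one pair in q were orthogonal, and `K` the error.
  orthogonal-pairs : ∀ (P : List V) → (∀ u → u ∈ P → proj₂ u ≢ 0ₚ) →
    q * ∑[ u ← P ] ∑[ u′ ← P ] 𝟙 (⟨ u , u′ ⟩ ≟ᶠ 0#) ≤
    + length P * + length P + q * q * ∑[ u ← P ] ∑[ u′ ← P ] δ u u′
  orthogonal-pairs P P≢0 = begin
    q * ∑[ u ← P ] ∑[ u′ ← P ] 𝟙 (⟨ u , u′ ⟩ ≟ᶠ 0#)
      ≡⟨ trans (∑-cong P (λ u → ∑-*ˡ q P _)) (∑-*ˡ q P _) ⟨
    ∑[ u ← P ] ∑[ u′ ← P ] (q * 𝟙 (⟨ u , u′ ⟩ ≟ᶠ 0#))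
      ≡⟨ ∑-cong P (λ u → ∑-cong P (λ u′ →
           solve 1 (λ a → a := con 1ℤ :+ (a :- con 1ℤ)) refl (q * 𝟙 (⟨ u , u′ ⟩ ≟ᶠ 0#)))) ⟩
    ∑[ u ← P ] ∑[ u′ ← P ] (1ℤ + K ⟨ u , u′ ⟩)
      ≡⟨ trans (∑-cong P (λ u → ∑-+ P (λ _ → 1ℤ) (λ u′ → K ⟨ u , u′ ⟩))) (∑-+ P _ _) ⟩
    ∑[ _ ← P ] ∑[ _ ← P ] 1ℤ + ∑[ u ← P ] ∑[ u′ ← P ] K ⟨ u , u′ ⟩
      ≡⟨ cong (_+ ∑[ u ← P ] ∑[ u′ ← P ] K ⟨ u , u′ ⟩) (trans (∑-const P _)
           (cong (+ length P *_) (trans (∑-const P 1ℤ) (ℤ.*-identityʳ _)))) ⟩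
    + length P * + length P + ∑[ u ← P ] ∑[ u′ ← P ] K ⟨ u , u′ ⟩
      ≤⟨ ℤ.+-monoʳ-≤ (+ length P * + length P) (∑-K≤∑-δ P P≢0) ⟩
    + length P * + length P + q * q * ∑[ u ← P ] ∑[ u′ ← P ] δ u u′ ∎
    where open ℤ.≤-Reasoning

any-true : ∀ {X : Set} (f : X → Bool) {xs x} → x ∈ xs → f x ≡ true → any f xs ≡ true
any-true f (here refl) fx rewrite fx = refl
any-true f {y ∷ _} (there x∈xs) fx rewrite any-true f x∈xs fx = ∨-zeroʳ (f y)

-- From pairs of vectors to incidences.

module Incidences (p : ℕ) .{{_ : NonZero p}} (p-prime : Prime p) where

  open ListSums
  open import Data.Integer using (_+_; _*_; _≤_; +≤+)
  open Residues p hiding (module Solver)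
  open Geometry p p-prime
  open SecondMoment p p-prime

  unit≢0 : ∀ {a} → a ≡ 1# → a ≢ 0#
  unit≢0 a≡1 a≡0 = 1≢0 (trans (sym a≡1) a≡0)

  -- Proportional pairs

  onLine-· : ∀ t v → onLine p v (t · v) ≡ true
  onLine-· t v = any-true (λ s → does (scale p s v ≟ₚ (t · v))) (∈-allFin t)
    (dec-true (scale p t v ≟ₚ (t · v)) (scale≡· t v))

  -- For `w` dual to `y`, a multiple (x′ , y′) = t (x , y) has t = `det y′ w`. Thus `y′` fixes both
  -- t and x′, and each `y′` on the line of `y` is counted at most once.
  ∑-δ≤lineCount : ∀ {A} B → Unique A → ∀ x y → y ≢ 0ₚ →
    ∑[ v ← cartesianProduct A B ] δ (x , y) v ≤ + lineCount p y B
  ∑-δ≤lineCount {A} B A! x y y≢0 = case det-dual y y≢0 of λ where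
      (w , yw≡1) → begin
        ∑[ v ← cartesianProduct A B ] δ (x , y) v
          ≡⟨ ∑-cartesianProduct A B (δ (x , y)) ⟩
        ∑[ x′ ← A ] ∑[ y′ ← B ] δ (x , y) (x′ , y′)
          ≡⟨ ∑-swap A B (λ x′ y′ → δ (x , y) (x′ , y′)) ⟩
        ∑[ y′ ← B ] ∑[ x′ ← A ] δ (x , y) (x′ , y′)
          ≤⟨ ∑-mono B (λ y′ → fibre w yw≡1 y′) ⟩
        ∑[ y′ ← B ] 𝟙 (onLine p y y′ Bool.≟ true)
          ≡⟨ ∑-𝟙-filter (λ y′ → onLine p y y′ Bool.≟ true) B ⟩
        + lineCount p y B ∎
    where
    open ℤ.≤-Reasoning
    fibre : ∀ w → det y w ≡ 1# → ∀ y′ →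
      ∑[ x′ ← A ] δ (x , y) (x′ , y′) ≤ 𝟙 (onLine p y y′ Bool.≟ true)
    fibre w yw≡1 y′ = begin
      ∑[ x′ ← A ] ∑[ t ← scalars ] (ν t * 𝟙 ((x′ , y′) ≟ᵥ (t ·ᵥ (x , y))))
        ≤⟨ ∑-mono A (λ x′ → ∑-mono scalars (λ t → term x′ t)) ⟩
      ∑[ x′ ← A ] ∑[ t ← scalars ] (c * (𝟙 (t ≟ᶠ det y′ w) * 𝟙 (x′ ≟ₚ (det y′ w · x))))
        ≡⟨ ∑-cong A (λ x′ → trans (∑-*ˡ c scalars _)
             (cong (c *_) (Scalars.∑-δ (λ _ → 𝟙 (x′ ≟ₚ (det y′ w · x))) (det y′ w)))) ⟩
      ∑[ x′ ← A ] (c * 𝟙 (x′ ≟ₚ (det y′ w · x)))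
        ≡⟨ ∑-*ˡ c A _ ⟩
      c * ∑[ x′ ← A ] 𝟙 (x′ ≟ₚ (det y′ w · x))
        ≤⟨ 𝟙-*-monoʳ (onLine p y y′ Bool.≟ true) (∑-𝟙-unique-≤1 _≟ₚ_ A! (det y′ w · x)) ⟩
      c * 1ℤ ≡⟨ ℤ.*-identityʳ c ⟩
      c ∎
      where
      c : ℤ
      c = 𝟙 (onLine p y y′ Bool.≟ true)
      scalar : ∀ t → det (t · y) w ≡ t
      scalar t = trans (det-·ˡ t y w) (trans (cong (t ⊗_) yw≡1)
        (R.solve 1 (λ t → t R.:* R.con 1ℤ R.:= t) refl t))
      term : ∀ x′ t → ν t * 𝟙 ((x′ , y′) ≟ᵥ (t ·ᵥ (x , y))) ≤
        c * (𝟙 (t ≟ᶠ det y′ w) * 𝟙 (x′ ≟ₚ (det y′ w · x)))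
      term x′ t = subst (λ z → ν t * 𝟙 ((x′ , y′) ≟ᵥ (t ·ᵥ (x , y))) ≤ c * z)
        (𝟙-× (t ≟ᶠ det y′ w) (x′ ≟ₚ (det y′ w · x)))
        (𝟙-*-mono (¬? (t ≟ᶠ 0#)) ((x′ , y′) ≟ᵥ (t ·ᵥ (x , y))) (onLine p y y′ Bool.≟ true)
          ((t ≟ᶠ det y′ w) ×-dec (x′ ≟ₚ (det y′ w · x)))
          (λ { _ refl → onLine-· t y , sym (scalar t) , cong (_· x) (sym (scalar t)) }))

  -- Matrices carrying two given points to two given points

  hit : Mat p → V → ℤ
  hit θ (x , y) = 𝟙 (act p θ y ≟ₚ x)

  module _ {S : List (Mat p)} (S! : Unique S) (S⊆SL₂ : All (InSL2 p) S) where

    det-hit : ∀ {θ} → θ ∈ S → ∀ {y y′ x x′} → act p θ y ≡ x → act p θ y′ ≡ x′ → det x x′ ≡ det y y′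
    det-hit {θ} θ∈S {y} {y′} refl refl =
      trans (cong₂ det (act≡▹ θ y) (act≡▹ θ y′)) (det-▹ θ (All.lookup S⊆SL₂ θ∈S) y y′)

    hit-determines : ∀ {θ e y y′ x x′} → e ⊗ det y y′ ≡ 1# → act p θ y ≡ x → act p θ y′ ≡ x′ →
      θ ≡ sending e y y′ x x′
    hit-determines {θ} {e} {y} {y′} e≡ refl refl = trans (sending-▹ y y′ e≡ θ)
      (cong₂ (sending e y y′) (sym (act≡▹ θ y)) (sym (act≡▹ θ y′)))

    -- For nonzero `x`, the matrices of determinant 1 taking `y` to `x` form a coset of the
    -- stabiliser of `y`, a group of order p.
    ∑-hit≤q : ∀ x y → y ≢ 0ₚ → ∑[ θ ← S ] hit θ (x , y) ≤ q
    ∑-hit≤q x y y≢0 = case det-dual y y≢0 of λ where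
        (w , yw≡1) → case x ≟ₚ 0ₚ of λ where
          -- No θ of determinant 1 kills `y`: the images of `y` and `w` still have determinant 1.
          (yes x≡0) → begin
            ∑[ θ ← S ] hit θ (x , y)
              ≡⟨ ∑-cong-∈ S (λ θ θ∈S → 𝟙-false (act p θ y ≟ₚ x) (λ θy≡x →
                   unit≢0 yw≡1 (trans (sym (det-hit θ∈S θy≡x refl))
                     (trans (cong (λ z → det z (act p θ w)) x≡0) (det-zeroˡ _))))) ⟩
            ∑[ θ ← S ] 0ℤ ≡⟨ ∑-zero S ⟩
            0ℤ            ≤⟨ +≤+ ℕ.z≤n ⟩
            q             ∎
          (no x≢0) → case det-dual x x≢0 of λ where
            (b , xb≡1) → begin
              ∑[ θ ← S ] hit θ (x , y)
                ≤⟨ ∑-mono-∈ S (λ θ θ∈S → coset w yw≡1 b xb≡1 θ θ∈S) ⟩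
              ∑[ θ ← S ] ∑[ s ← scalars ] 𝟙 (θ ≟ₘ sending 1# y w x (s · x +ₚ 1# · b))
                ≡⟨ ∑-swap S scalars (λ θ s → 𝟙 (θ ≟ₘ sending 1# y w x (s · x +ₚ 1# · b))) ⟩
              ∑[ s ← scalars ] ∑[ θ ← S ] 𝟙 (θ ≟ₘ sending 1# y w x (s · x +ₚ 1# · b))
                ≤⟨ ∑-mono scalars (λ s → ∑-𝟙-unique-≤1 _≟ₘ_ S! (sending 1# y w x (s · x +ₚ 1# · b))) ⟩
              ∑[ s ← scalars ] 1ℤ ≡⟨ trans (∑-scalars-const 1ℤ) (ℤ.*-identityʳ q) ⟩
              q ∎
      where
      open ℤ.≤-Reasoning
      -- θ carries the basis (y , w) to (x , θw), where det x (θw) = 1 confines θw to a coset of the line of x.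
      coset : ∀ w → det y w ≡ 1# → ∀ b → det x b ≡ 1# → ∀ θ → θ ∈ S →
        hit θ (x , y) ≤ ∑[ s ← scalars ] 𝟙 (θ ≟ₘ sending 1# y w x (s · x +ₚ 1# · b))
      coset w yw≡1 b xb≡1 θ θ∈S = 𝟙-≤-if (act p θ y ≟ₚ x)
        -- The witness for s is the `x`-coordinate of θ w in the basis `(x , b)`.
        (λ θy≡x → ℤ.≤-trans (∑-𝟙-∈-≥1 _≟ᶠ_ (∈-allFin (det (act p θ w) b)))
          (∑-mono scalars (λ s → 𝟙-mono (s ≟ᶠ det (act p θ w) b) (θ ≟ₘ _) (λ { refl →
            hit-determines (trans (⊗-identityˡ _) yw≡1) θy≡x
              (trans (expand-in-basis xb≡1 (act p θ w))
                (cong (λ z → det (act p θ w) b · x +ₚ z · b)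
                  (trans (det-hit θ∈S θy≡x refl) yw≡1))) }))))
        (∑-nonneg scalars (λ s → 𝟙-nonneg (θ ≟ₘ _)))

    -- A matrix is determined by its values on the basis `y`, `y′`, and a common θ forces the pair
    -- to be orthogonal since it preserves `det`.
    ∑-hit²-transverse : ∀ x y x′ y′ → det y y′ ≢ 0# →
      ∑[ θ ← S ] (hit θ (x , y) * hit θ (x′ , y′)) ≤ 𝟙 (⟨ (x , y) , (x′ , y′) ⟩ ≟ᶠ 0#)
    ∑-hit²-transverse x y x′ y′ yy′≢0 = case inverse (det y y′) yy′≢0 of λ where
        (e , e≡) → begin
          ∑[ θ ← S ] (hit θ (x , y) * hit θ (x′ , y′))
            ≤⟨ ∑-mono-∈ S (λ θ θ∈S → 𝟙-*-mono (act p θ y ≟ₚ x) (act p θ y′ ≟ₚ x′)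
                 (⟨ (x , y) , (x′ , y′) ⟩ ≟ᶠ 0#) (θ ≟ₘ sending e y y′ x x′)
                 (λ θy≡x θy′≡x′ → trans (cong (λ z → z ⊕ ⊖ det y y′) (det-hit θ∈S θy≡x θy′≡x′))
                     (⊖-inverseʳ (det y y′)) , hit-determines e≡ θy≡x θy′≡x′)) ⟩
          ∑[ θ ← S ] (c * 𝟙 (θ ≟ₘ sending e y y′ x x′))
            ≡⟨ ∑-*ˡ c S _ ⟩
          c * ∑[ θ ← S ] 𝟙 (θ ≟ₘ sending e y y′ x x′)
            ≤⟨ 𝟙-*-monoʳ (⟨ (x , y) , (x′ , y′) ⟩ ≟ᶠ 0#) (∑-𝟙-unique-≤1 _≟ₘ_ S! _) ⟩
          c * 1ℤ ≡⟨ ℤ.*-identityʳ c ⟩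
          c ∎
      where
      open ℤ.≤-Reasoning
      c : ℤ
      c = 𝟙 (⟨ (x , y) , (x′ , y′) ⟩ ≟ᶠ 0#)

    -- By linearity θ y = x implies θ (t y) = t x. Hence no θ qualifies unless x′ = t x, and then
    -- the second condition follows from the first.
    ∑-hit²-parallel : ∀ x y x′ t → y ≢ 0ₚ → t · y ≢ 0ₚ →
      ∑[ θ ← S ] (hit θ (x , y) * hit θ (x′ , t · y)) ≤ q * δ (x , y) (x′ , t · y)
    ∑-hit²-parallel x y x′ t y≢0 ty≢0 = case x′ ≟ₚ (t · x) of λ where
        (no x′≢tx) → begin
          ∑[ θ ← S ] (hit θ (x , y) * hit θ (x′ , t · y))
            ≡⟨ ∑-cong S (λ θ → trans (sym (𝟙-× (act p θ y ≟ₚ x) (act p θ (t · y) ≟ₚ x′)))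
                 (𝟙-false ((act p θ y ≟ₚ x) ×-dec (act p θ (t · y) ≟ₚ x′))
                   (λ (θy≡x , θty≡x′) → x′≢tx (scaled-image θ θy≡x θty≡x′)))) ⟩
          ∑[ θ ← S ] 0ℤ ≡⟨ ∑-zero S ⟩
          0ℤ ≡⟨ ℤ.*-zeroʳ q ⟨
          q * 0ℤ ≤⟨ ℤ.*-monoˡ-≤-nonNeg q (δ-nonneg (x , y) (x′ , t · y)) ⟩
          q * δ (x , y) (x′ , t · y) ∎
        (yes refl) → case nondegenerate x y y≢0 of λ where
          (w , uw≡1) → begin
            ∑[ θ ← S ] (hit θ (x , y) * hit θ (t · x , t · y))
              ≤⟨ ∑-mono S (λ θ → subst (_≤ hit θ (x , y))
                   (𝟙-× (act p θ y ≟ₚ x) (act p θ (t · y) ≟ₚ (t · x)))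
                   (𝟙-mono ((act p θ y ≟ₚ x) ×-dec (act p θ (t · y) ≟ₚ (t · x))) (act p θ y ≟ₚ x) proj₁)) ⟩
            ∑[ θ ← S ] hit θ (x , y) ≤⟨ ∑-hit≤q x y y≢0 ⟩
            q ≡⟨ ℤ.*-identityʳ q ⟨
            q * 1ℤ ≡⟨ cong (q *_) (δ-proportional (x , y) w t uw≡1 (λ { refl → ty≢0 (·-zeroˡ y) })) ⟨
            q * δ (x , y) (t · x , t · y) ∎
      where
      open ℤ.≤-Reasoning
      scaled-image : ∀ θ → act p θ y ≡ x → act p θ (t · y) ≡ x′ → x′ ≡ t · x
      scaled-image θ refl refl =
        trans (act≡▹ θ (t · y)) (trans (▹-· θ t y) (cong (t ·_) (sym (act≡▹ θ y))))

    -- The two terms answer to the two cases: independent pairs need only the indicator, parallel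
    -- ones only `δ`.
    ∑-hit² : ∀ u u′ → proj₂ u ≢ 0ₚ → proj₂ u′ ≢ 0ₚ →
      ∑[ θ ← S ] (hit θ u * hit θ u′) ≤ 𝟙 (⟨ u , u′ ⟩ ≟ᶠ 0#) + q * δ u u′
    ∑-hit² (x , y) (x′ , y′) y≢0 y′≢0 = case det y y′ ≟ᶠ 0# of λ where
        (no yy′≢0) → ℤ.≤-trans (∑-hit²-transverse x y x′ y′ yy′≢0)
          (subst (_≤ orth + q * δ (x , y) (x′ , y′)) (ℤ.+-identityʳ orth) (ℤ.+-monoʳ-≤ orth
            (subst (_≤ q * δ (x , y) (x′ , y′)) (ℤ.*-zeroʳ q)
              (ℤ.*-monoˡ-≤-nonNeg q (δ-nonneg (x , y) (x′ , y′))))))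
        (yes yy′≡0) → case parallel y≢0 yy′≡0 of λ where
          (t , refl) → ℤ.≤-trans (∑-hit²-parallel x y x′ t y≢0 y′≢0)
            (subst (_≤ orth + q * δ (x , y) (x′ , y′)) (ℤ.+-identityˡ _)
              (ℤ.+-monoˡ-≤ (q * δ (x , y) (x′ , y′)) (𝟙-nonneg (⟨ (x , y) , (x′ , y′) ⟩ ≟ᶠ 0#))))
      where
      orth : ℤ
      orth = 𝟙 (⟨ (x , y) , (x′ , y′) ⟩ ≟ᶠ 0#)

    ∑-hit-bound : ∀ (P : List V) → (∀ u → u ∈ P → proj₂ u ≢ 0ₚ) → ∀ {k} →
      (∀ u → u ∈ P → ∑[ v ← P ] δ u v ≤ + k) →
      q * (∑[ θ ← S ] ∑[ u ← P ] hit θ u * ∑[ θ ← S ] ∑[ u ← P ] hit θ u) ≤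
      + length S * (+ length P * + length P + + 2 * (q * q * (+ length P * + k)))
    ∑-hit-bound P P≢0 {k} δ≤k = begin
      q * (∑[ θ ← S ] r θ * ∑[ θ ← S ] r θ)
        ≤⟨ ℤ.*-monoˡ-≤-nonNeg q (cauchy-schwarz S r) ⟩
      q * (s * ∑[ θ ← S ] (r θ * r θ))
        ≤⟨ ℤ.*-monoˡ-≤-nonNeg q (ℤ.*-monoˡ-≤-nonNeg s energy) ⟩
      q * (s * (Q + q * D))
        ≡⟨ solve 4 (λ q s Q D → q :* (s :* (Q :+ q :* D)) := s :* (q :* Q :+ q :* q :* D)) refl q s Q D ⟩
      s * (q * Q + q * q * D)
        ≤⟨ ℤ.*-monoˡ-≤-nonNeg s (ℤ.+-monoˡ-≤ (q * q * D) (orthogonal-pairs P P≢0)) ⟩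
      s * (n * n + q * q * D + q * q * D)
        -- The factor 2: one q² D comes from the matrices shared by parallel pairs, the other from
        -- the second moment.
        ≡⟨ solve 4 (λ q s n D → s :* (n :* n :+ q :* q :* D :+ q :* q :* D) :=
             s :* (n :* n :+ con (+ 2) :* (q :* (q :* D)))) refl q s n D ⟩
      s * (n * n + + 2 * (q * (q * D)))
        ≤⟨ ℤ.*-monoˡ-≤-nonNeg s (ℤ.+-monoʳ-≤ (n * n) (ℤ.*-monoˡ-≤-nonNeg (+ 2)
             (ℤ.*-monoˡ-≤-nonNeg q (ℤ.*-monoˡ-≤-nonNeg q D≤nk)))) ⟩
      s * (n * n + + 2 * (q * (q * (n * + k))))
        ≡⟨ cong (λ z → s * (n * n + + 2 * z)) (ℤ.*-assoc q q (n * + k)) ⟨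
      s * (n * n + + 2 * (q * q * (n * + k))) ∎
      where
      open ℤ.≤-Reasoning
      open +-*-Solver
      r : Mat p → ℤ
      r θ = ∑[ u ← P ] hit θ u
      s n Q D : ℤ
      s = + length S
      n = + length P
      Q = ∑[ u ← P ] ∑[ u′ ← P ] 𝟙 (⟨ u , u′ ⟩ ≟ᶠ 0#)
      D = ∑[ u ← P ] ∑[ u′ ← P ] δ u u′
      D≤nk : D ≤ n * + k
      D≤nk = ℤ.≤-trans (∑-mono-∈ P δ≤k) (ℤ.≤-reflexive (∑-const P (+ k)))
      energy : ∑[ θ ← S ] (r θ * r θ) ≤ Q + q * D
      energy = begin
        ∑[ θ ← S ] (r θ * r θ)
          ≡⟨ ∑-cong S (λ θ → ∑-*-∑ P P (hit θ) (hit θ)) ⟩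
        ∑[ θ ← S ] ∑[ u ← P ] ∑[ u′ ← P ] (hit θ u * hit θ u′)
          ≡⟨ ∑-swap S P (λ θ u → ∑[ u′ ← P ] (hit θ u * hit θ u′)) ⟩
        ∑[ u ← P ] ∑[ θ ← S ] ∑[ u′ ← P ] (hit θ u * hit θ u′)
          ≡⟨ ∑-cong P (λ u → ∑-swap S P (λ θ u′ → hit θ u * hit θ u′)) ⟩
        ∑[ u ← P ] ∑[ u′ ← P ] ∑[ θ ← S ] (hit θ u * hit θ u′)
          ≤⟨ ∑-mono-∈ P (λ u u∈P → ∑-mono-∈ P (λ u′ u′∈P → ∑-hit² u u′ (P≢0 u u∈P) (P≢0 u′ u′∈P))) ⟩
        ∑[ u ← P ] ∑[ u′ ← P ] (𝟙 (⟨ u , u′ ⟩ ≟ᶠ 0#) + q * δ u u′)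
          ≡⟨ ∑-cong P (λ u → trans (∑-+ P (λ u′ → 𝟙 (⟨ u , u′ ⟩ ≟ᶠ 0#)) (λ u′ → q * δ u u′))
               (cong (λ z → ∑[ u′ ← P ] 𝟙 (⟨ u , u′ ⟩ ≟ᶠ 0#) + z) (∑-*ˡ q P (δ u)))) ⟩
        ∑[ u ← P ] (∑[ u′ ← P ] 𝟙 (⟨ u , u′ ⟩ ≟ᶠ 0#) + q * ∑[ u′ ← P ] δ u u′)
          ≡⟨ trans (∑-+ P (λ u → ∑[ u′ ← P ] 𝟙 (⟨ u , u′ ⟩ ≟ᶠ 0#)) (λ u → q * ∑[ u′ ← P ] δ u u′))
               (cong (λ z → Q + z) (∑-*ˡ q P (λ u → ∑[ u′ ← P ] δ u u′))) ⟩
        Q + q * D ∎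

  -- Duals and the dichotomy need a nonzero second half, so the counting runs over `A` times the
  -- nonzero part of `B`.
  nonzero : List (Pt p) → List (Pt p)
  nonzero = filter (λ y → ¬? (y ≟ₚ 0ₚ))

  act-0ₚ : ∀ θ → act p θ 0ₚ ≡ 0ₚ
  act-0ₚ θ@(a , b , c , d) = trans (act≡▹ θ 0ₚ) (cong₂ _,_ (zero² a b) (zero² c d))
    where
    zero² : ∀ a b → a ⊗ 0# ⊕ b ⊗ 0# ≡ 0#
    zero² = R.solve 2 (λ a b → a R.:* R.con 0ℤ R.:+ b R.:* R.con 0ℤ R.:= R.con 0ℤ) refl

  incidences≡∑-hit : ∀ A B S → (∀ x y → x ∈ A → y ∈ B → ¬ (x ≡ 0ₚ × y ≡ 0ₚ)) →
    + incidences p A B S ≡ ∑[ θ ← S ] ∑[ u ← cartesianProduct A (nonzero B) ] hit θ u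
  incidences≡∑-hit A B S ∌0 = begin
    + incidences p A B S
      ≡⟨ trans (pos-sum A _) (∑-cong A (λ x → trans (pos-sum B _) (∑-cong B (λ y →
           trans (pos-sum S _) (∑-cong S (λ θ → pos-if (act p θ y ≟ₚ x))))))) ⟩
    ∑[ x ← A ] ∑[ y ← B ] ∑[ θ ← S ] hit θ (x , y)
      ≡⟨ ∑-cong-∈ A (λ x x∈A → sym (∑-filter-≡ (λ y → ¬? (y ≟ₚ 0ₚ)) B (λ y y∈B y≡0 → vanish x∈A y∈B y≡0))) ⟩
    ∑[ x ← A ] ∑[ y ← nonzero B ] ∑[ θ ← S ] hit θ (x , y)
      ≡⟨ ∑-cartesianProduct A (nonzero B) (λ u → ∑[ θ ← S ] hit θ u) ⟨
    ∑[ u ← cartesianProduct A (nonzero B) ] ∑[ θ ← S ] hit θ u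
      ≡⟨ ∑-swap (cartesianProduct A (nonzero B)) S (λ u θ → hit θ u) ⟩
    ∑[ θ ← S ] ∑[ u ← cartesianProduct A (nonzero B) ] hit θ u ∎
    where
    open ≡-Reasoning
    pos-if : ∀ {X : Set} (X? : Dec X) → + (if does X? then 1 else 0) ≡ 𝟙 X?
    pos-if (yes _) = refl
    pos-if (no _)  = refl
    vanish : ∀ {x y} → x ∈ A → y ∈ B → ¬ (y ≢ 0ₚ) → ∑[ θ ← S ] hit θ (x , y) ≡ 0ℤ
    vanish {x} {y} x∈A y∈B ¬y≢0 = case y ≟ₚ 0ₚ of λ where
      (no y≢0)   → contradiction y≢0 ¬y≢0
      (yes refl) → trans (∑-cong S (λ θ → 𝟙-false (act p θ 0ₚ ≟ₚ x) (λ θ0≡x →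
        ∌0 x 0ₚ x∈A y∈B (trans (sym θ0≡x) (act-0ₚ θ) , refl)))) (∑-zero S)

  lineCount-nonzero : ∀ y B → lineCount p y (nonzero B) ℕ.≤ lineCount p y B
  lineCount-nonzero y B = ℤ.drop‿+≤+ (subst₂ _≤_
    (∑-𝟙-filter onLine? (nonzero B)) (∑-𝟙-filter onLine? B)
    (∑-filter-≤ (λ y → ¬? (y ≟ₚ 0ₚ)) B (λ y′ → 𝟙-nonneg (onLine? y′))))
    where
    onLine? : ∀ y′ → Dec (onLine p y y′ ≡ true)
    onLine? y′ = onLine p y y′ Bool.≟ true

  incidence-bound : ∀ A B S k → Unique A → Unique S → All (InSL2 p) S →
    (∀ x y → x ∈ A → y ∈ B → ¬ (x ≡ 0ₚ × y ≡ 0ₚ)) →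
    (∀ v → v ≢ 0ₚ → lineCount p v B ℕ.≤ k) →
    let n = length A ℕ.* length (nonzero B) in
    p ℕ.* (incidences p A B S ℕ.* incidences p A B S) ℕ.≤
    length S ℕ.* (n ℕ.* n ℕ.+ 2 ℕ.* (p ℕ.* p ℕ.* (n ℕ.* k)))
  incidence-bound A B S k A! S! S⊆SL₂ ∌0 line≤k = ℤ.drop‿+≤+ (subst₂ _≤_ lhs rhs
    (∑-hit-bound S! S⊆SL₂ P P≢0 δ≤k))
    where
    open ≡-Reasoning
    P : List V
    P = cartesianProduct A (nonzero B)
    n I : ℕ
    n = length A ℕ.* length (nonzero B)
    I = incidences p A B S
    P≢0 : ∀ u → u ∈ P → proj₂ u ≢ 0ₚ
    P≢0 u u∈P = proj₂ (∈-filter⁻ (λ y → ¬? (y ≟ₚ 0ₚ)) {xs = B} (proj₂ (∈-cartesianProduct⁻ A (nonzero B) u∈P)))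
    δ≤k : ∀ u → u ∈ P → ∑[ v ← P ] δ u v ≤ + k
    δ≤k u@(x , y) u∈P = ℤ.≤-trans (∑-δ≤lineCount (nonzero B) A! x y (P≢0 u u∈P))
      (+≤+ (ℕ.≤-trans (lineCount-nonzero y B) (line≤k y (P≢0 u u∈P))))
    lhs : q * (∑[ θ ← S ] ∑[ u ← P ] hit θ u * ∑[ θ ← S ] ∑[ u ← P ] hit θ u) ≡ + (p ℕ.* (I ℕ.* I))
    lhs = begin
      q * (∑[ θ ← S ] ∑[ u ← P ] hit θ u * ∑[ θ ← S ] ∑[ u ← P ] hit θ u)
        ≡⟨ cong (λ z → q * (z * z)) (incidences≡∑-hit A B S ∌0) ⟨
      q * (+ I * + I)      ≡⟨ cong (q *_) (ℤ.pos-* I I) ⟨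
      q * + (I ℕ.* I)      ≡⟨ ℤ.pos-* p (I ℕ.* I) ⟨
      + (p ℕ.* (I ℕ.* I))  ∎
    rhs : + length S * (+ length P * + length P + + 2 * (q * q * (+ length P * + k))) ≡
      + (length S ℕ.* (n ℕ.* n ℕ.+ 2 ℕ.* (p ℕ.* p ℕ.* (n ℕ.* k))))
    rhs = begin
      + length S * (+ length P * + length P + + 2 * (q * q * (+ length P * + k)))
        ≡⟨ cong (λ m → + length S * (+ m * + m + + 2 * (q * q * (+ m * + k))))
             (length-cartesianProduct A (nonzero B)) ⟩
      + length S * (+ n * + n + + 2 * (q * q * (+ n * + k)))
        ≡⟨ cong₂ (λ a b → + length S * (a + + 2 * b)) (ℤ.pos-* n n)
             (trans (ℤ.pos-* (p ℕ.* p) (n ℕ.* k)) (cong₂ _*_ (ℤ.pos-* p p) (ℤ.pos-* n k))) ⟨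
      + length S * (+ (n ℕ.* n) + + 2 * + (p ℕ.* p ℕ.* (n ℕ.* k)))
        ≡⟨ cong (λ z → + length S * (+ (n ℕ.* n) + z)) (ℤ.pos-* 2 (p ℕ.* p ℕ.* (n ℕ.* k))) ⟨
      + length S * + (n ℕ.* n ℕ.+ 2 ℕ.* (p ℕ.* p ℕ.* (n ℕ.* k)))
        ≡⟨ ℤ.pos-* (length S) _ ⟨
      + (length S ℕ.* (n ℕ.* n ℕ.+ 2 ℕ.* (p ℕ.* p ℕ.* (n ℕ.* k)))) ∎

-- The bound in terms of the full list `B` and the logarithm.

open import Data.Nat using (_+_; _*_; _≤_)

⌊log₂p⌋≥1 : ∀ {p} → Prime p → 1 ≤ ⌊log₂ p ⌋
⌊log₂p⌋≥1 {p} p-prime = subst (_≤ ⌊log₂ p ⌋) (⌊log₂[2^n]⌋≡n 1)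
  (⌊log₂⌋-mono-≤ (nonTrivial⇒n>1 p {{prime⇒nonTrivial p-prime}}))

theorem2p11 : ∃[ C ] ∀ (p : ℕ) .{{_ : NonZero p}} → Prime p → ¬ (2 ∣ p) →
    (A B : List (Pt p)) (S : List (Mat p)) (k : ℕ) →
    Unique A → Unique B → Unique S → All (InSL2 p) S →
    (∀ x y → x ∈ A → y ∈ B → ¬ (x ≡ origin p × y ≡ origin p)) →
    (∀ v → v ≢ origin p → lineCount p v B ≤ k) →
    p * (incidences p A B S * incidences p A B S)
    ≤ C * (⌊log₂ p ⌋ * ⌊log₂ p ⌋)
    * (length A * length A * length B * length B * length S
    + k * p * p * length A * length B * length S
    + p * k * k * length S * length S)
theorem2p11 = 2 , λ p p-prime _ A B S k A! _ S! S⊆SL₂ ∌0 line≤k →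
  let open Incidences p p-prime
      open ℕ.≤-Reasoning
      open Data.Nat.Solver.+-*-Solver
      a = length A
      b = length B
      s = length S
      n = a * length (nonzero B)
      n≤ab : n ≤ a * b
      n≤ab = ℕ.*-monoʳ-≤ a (length-filter (λ y → ¬? (y ≟ₚ origin p)) B)
      L = ⌊log₂ p ⌋
      M = a * a * b * b * s + k * p * p * a * b * s
  in begin
    p * (incidences p A B S * incidences p A B S)
      ≤⟨ incidence-bound A B S k A! S! S⊆SL₂ ∌0 line≤k ⟩
    s * (n * n + 2 * (p * p * (n * k)))
      ≤⟨ ℕ.*-monoʳ-≤ s (ℕ.+-mono-≤ (ℕ.*-mono-≤ n≤ab n≤ab)
           (ℕ.*-monoʳ-≤ 2 (ℕ.*-monoʳ-≤ (p * p) (ℕ.*-monoˡ-≤ k n≤ab)))) ⟩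
    s * (a * b * (a * b) + 2 * (p * p * (a * b * k)))
      -- Doubling the first term gives both terms the coefficient 2, which is the constant of the
      -- theorem.
      ≤⟨ ℕ.m≤m+n _ (a * a * b * b * s) ⟩
    s * (a * b * (a * b) + 2 * (p * p * (a * b * k))) + a * a * b * b * s
      ≡⟨ solve 5 (λ p a b s k →
           s :* (a :* b :* (a :* b) :+ con 2 :* (p :* p :* (a :* b :* k))) :+ a :* a :* b :* b :* s :=
           con 2 :* (a :* a :* b :* b :* s :+ k :* p :* p :* a :* b :* s)) refl p a b s k ⟩
    2 * M
      -- The logarithm of a prime is at least 1, and the third term is nonnegative.
      ≤⟨ ℕ.*-mono-≤ (ℕ.*-monoʳ-≤ 2 (ℕ.*-mono-≤ (⌊log₂p⌋≥1 p-prime) (⌊log₂p⌋≥1 p-prime)))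
           (ℕ.m≤m+n M (p * k * k * s * s)) ⟩
    2 * (L * L) * (M + p * k * k * s * s) ∎
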